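{- There exist absolute constants $c_1,c_2>0$ such that for infinitely many $n\in\mathbb{N}$ there exists a bipartite graph $G$ with $n$ vertices and minimum degree at least $c_1 n$ such that, in the random order model, the expected number of colors used by FirstFit on $G$ is at least $c_2\,\dfrac{\log n}{\log\log n}$.
   Context: FirstFit: given a finite simple graph and an ordering of its vertices, the vertices are processed in that order, and each vertex irrevocably receives the smallest positive integer (color) that is not the color of any of its neighbors processed earlier. The number of colors used is the number of distinct colors assigned. Random order model: the graph is fixed and the ordering of its vertices is chosen uniformly at random among all orderings; the expectation is over this choice. -}

module Defs where

open import Data.Bool using (Bool; if_then_else_)
open import Data.Fin using (Fin)
open import Data.Integer as ℤ using (ℤ; +_; -[1+_])
open import Data.List using (List; []; _∷_; [_]; map; concatMap; filter; foldl; length; allFin; deduplicate)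
open import Data.List.Membership.DecPropositional using (_∈?_)
open import Data.Nat as ℕ using (ℕ; zero; suc; _!)
open import Data.Nat.ListAction using (sum)
open import Data.Nat.Properties using (_!≢0)
open import Data.Product using (_×_; _,_; ∃-syntax; Σ-syntax; proj₁; proj₂)
open import Data.Rational as ℚ using (ℚ; 0ℚ; ½; _/_; _<_; _*_; ↥_; ↧ₙ_)
open import Algebra.Definitions.RawSemiring ℚ.+-*-rawSemiring using (_^_)
open import Level using (0ℓ)
open import Relation.Binary using (Rel; Decidable; Symmetric; Irreflexive)
open import Relation.Binary.PropositionalEquality using (_≡_; _≢_)
open import Relation.Nullary using (¬_; does)

------------------------------------------------------------------------
-- Graphs

record SimpleGraph (n : ℕ) : Set₁ where
  infix 4 _~_ _~?_
  field
    _~_      : Rel (Fin n) 0ℓ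
    _~?_     : Decidable _~_
    ~-sym    : Symmetric _~_
    ~-irrefl : Irreflexive _≡_ _~_

open SimpleGraph

Bipartite : ∀ {n} → SimpleGraph n → Set
Bipartite {n} G = Σ[ side ∈ (Fin n → Bool) ] (∀ u v → _~_ G u v → side u ≢ side v)

degree : ∀ {n} → SimpleGraph n → Fin n → ℕ
degree {n} G v = length (filter (_~?_ G v) (allFin n))

MinDegree≥ : ∀ {n} → SimpleGraph n → ℚ → Set
MinDegree≥ G d = ∀ v → d ℚ.≤ + degree G v / 1

------------------------------------------------------------------------
-- FirstFit

-- The first of c, c + 1, …, c + fuel not in cs (c + fuel is not tested).
search : List ℕ → ℕ → ℕ → ℕ
search cs zero       c = c
search cs (suc fuel) c = if does (_∈?_ ℕ._≟_ c cs) then search cs fuel (suc c) else c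

-- The smallest positive integer not in cs.  If 1, …, length cs all occur in cs
-- then nothing else does, so the last candidate needs no test.
leastMissing : List ℕ → ℕ
leastMissing cs = search cs (length cs) 1

-- The vertices processed so far, each with its colour.
PartialColouring : ℕ → Set
PartialColouring n = List (Fin n × ℕ)

colourNext : ∀ {n} → SimpleGraph n → PartialColouring n → Fin n → PartialColouring n
colourNext G done v =
  (v , leastMissing (map proj₂ (filter (λ uc → _~?_ G v (proj₁ uc)) done))) ∷ done

firstFit : ∀ {n} → SimpleGraph n → List (Fin n) → PartialColouring n
firstFit G order = foldl (colourNext G) [] order

coloursUsed : ∀ {n} → SimpleGraph n → List (Fin n) → ℕ
coloursUsed G order = length (deduplicate ℕ._≟_ (map proj₂ (firstFit G order)))

------------------------------------------------------------------------
-- Random order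

insertions : ∀ {A : Set} → A → List A → List (List A)
insertions x []       = [ [ x ] ]
insertions x (y ∷ ys) = (x ∷ y ∷ ys) ∷ map (y ∷_) (insertions x ys)

permutations : ∀ {A : Set} → List A → List (List A)
permutations []       = [ [] ]
permutations (x ∷ xs) = concatMap (insertions x) (permutations xs)

-- permutations (allFin n) lists each of the n ! orderings of Fin n exactly once.
expectedColours : ∀ {n} → SimpleGraph n → ℚ
expectedColours {n} G =
  (+ sum (map (coloursUsed G) (permutations (allFin n))) / n !) {{ n !≢0 }}

------------------------------------------------------------------------
-- Real numbers

-- A real number x as a two-sided Dedekind cut: q lies in `lower` when q < x
-- and in `upper` when x < q.  The cut axioms are not stored; they hold for each
-- operation below on arguments in its stated range.
record Cut : Set₁ where
  field
    lower : ℚ → Set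
    upper : ℚ → Set

open Cut

fromℕ : ℕ → Cut
fromℕ n .lower q = q < + n / 1
fromℕ n .upper q = + n / 1 < q

2^ℤ : ℤ → ℚ
2^ℤ (+ k)    = (+ 2 / 1) ^ k
2^ℤ -[1+ k ] = ½ ^ suc k

-- 2 ^ q < s and s < 2 ^ q for rational s > 0: with q = a / b, both sides are
-- raised to the power b, so that 2 ^ a is compared with s ^ b.
2^_<_ : ℚ → ℚ → Set
2^ q < s = 2^ℤ (↥ q) < s ^ ↧ₙ q

_<2^_ : ℚ → ℚ → Set
s <2^ q = s ^ ↧ₙ q < 2^ℤ (↥ q)

-- The base-2 logarithm of a real x > 0: q < log₂ x iff 2 ^ q < s < x for some
-- rational s, and dually.
log₂ : Cut → Cut
log₂ x .lower q = ∃[ s ] 0ℚ < s × 2^ q < s × lower x s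
log₂ x .upper q = ∃[ s ] 0ℚ < s × upper x s × s <2^ q

-- The quotient of reals x, y > 0: q < x / y iff q * b < a for some rationals
-- a < x and b > y, and dually.
_÷_ : Cut → Cut → Cut
(x ÷ y) .lower q = ∃[ a ] ∃[ b ] lower x a × upper y b × q * b < a
(x ÷ y) .upper q = ∃[ a ] ∃[ b ] upper x a × lower y b × 0ℚ < b × a < q * b

-- The multiple of a real by a rational c > 0.
_·_ : ℚ → Cut → Cut
(c · x) .lower q = ∃[ a ] lower x a × q < c * a
(c · x) .upper q = ∃[ a ] upper x a × c * a < q

_≥ᶜ_ : ℚ → Cut → Set
e ≥ᶜ x = ¬ lower x e

infixl 7 _÷_
infixr 6 _·_
infix  4 2^_<_ _<2^_ _≥ᶜ_

{-# OPTIONS --safe #-}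
module Submission where

-- Take (2k)! disjoint copies ("blocks") of K_{k,k} minus a perfect matching and
-- number the vertices of a block so that 2c and 2c + 1 are the matched pairs.
-- FirstFit needs k colours on a block whose vertices arrive in increasing order,
-- which has probability 1/(2k)!, independently for each block; so with
-- probability at least 1/2 some block arrives in this order.  To make the graph
-- dense, add two independent sets of hubs, each joined to one side of all the
-- blocks.  If the first two vertices are hubs of opposite sets (each of the two
-- cases has probability at least 1/16), then all hubs receive colour 1, so that the
-- only effect of the hubs on the blocks is to shift their colours by one.  Since
-- n = 4k (2k)!, the number k is of order log n / log log n.

-- Probabilities are counted as numbers of insertions. `permutations` builds every ordering by
-- inserting the vertices at all possible places, and the number of places depends only on the
-- length of the list. This replaces independence: whether a block arrives in increasing order is
-- decided by the insertion of its own vertices, whatever the list already contains. The vertices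
-- listed last are inserted first, so the hubs are numbered after the blocks: an ordering of the
-- hubs that begins with two opposite ones is extended by inserting the block vertices behind these
-- two, and all other extensions are dropped from the lower bound.
--
-- Hubs and blocks protect each other: a hub takes colour 1 as long as no block vertex has it, and a
-- block vertex avoids colour 1 once a hub of the opposite side has arrived. One early hub of each
-- set is therefore enough, and the remaining hubs may arrive at any time.

open import Defs

-- Counting orderings by successive insertion.

module Counting where

  open import Data.Bool using (if_then_else_)
  open import Data.List using (List; []; _∷_; _++_; map; concatMap; filter; length)
  open import Data.List.Properties using (map-∘; map-cong; map-++; length-++; filter-++; filter-accept; filter-reject; filter-none; ≡-dec)
  open import Data.List.Relation.Unary.All using (All; []; _∷_; universal)
  import Data.List.Relation.Unary.All as All
  import Data.List.Relation.Unary.All.Properties as All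
  open import Data.List.Relation.Unary.Unique.Propositional using (Unique; []; _∷_)
  open import Data.Nat
  open import Data.Nat.ListAction using (sum)
  open import Data.Nat.ListAction.Properties using (sum-++)
  open import Data.Nat.Properties
  open import Data.Nat.Tactic.RingSolver using (solve-∀)
  open import Data.Unit using (⊤)
  open import Function using (_∘_; const)
  open import Level using (0ℓ)
  open import Relation.Binary using (DecidableEquality)
  open import Relation.Binary.PropositionalEquality
  open import Relation.Nullary using (¬_; Dec; yes; no; does; contradiction)
  open import Relation.Nullary.Decidable using (dec-true; dec-false)
  open import Relation.Unary using (Pred; Decidable)

  private variable A : Set

  *-swapˡ : ∀ a b c → a * (b * c) ≡ b * (a * c)
  *-swapˡ = solve-∀

  -- insSum x f p sums f over insertions x p, and insSum* xs f p over the lists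
  -- obtained from p by inserting the elements of xs, the last one first.
  insSum : A → (List A → ℕ) → List A → ℕ
  insSum x f []       = f (x ∷ [])
  insSum x f (y ∷ ys) = f (x ∷ y ∷ ys) + insSum x (f ∘ (y ∷_)) ys

  insSum* : List A → (List A → ℕ) → List A → ℕ
  insSum* []       f = f
  insSum* (x ∷ xs) f = insSum* xs (insSum x f)

  insSum-insertions : ∀ (x : A) f p → sum (map f (insertions x p)) ≡ insSum x f p
  insSum-insertions x f []       = +-identityʳ _
  insSum-insertions x f (y ∷ ys) = cong (f (x ∷ y ∷ ys) +_) (begin
    sum (map f (map (y ∷_) (insertions x ys)))  ≡⟨ cong sum (map-∘ (insertions x ys)) ⟨
    sum (map (f ∘ (y ∷_)) (insertions x ys))    ≡⟨ insSum-insertions x (f ∘ (y ∷_)) ys ⟩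
    insSum x (f ∘ (y ∷_)) ys                    ∎)
    where open ≡-Reasoning

  sum-concatMap : ∀ {B : Set} (f : B → ℕ) (g : A → List B) xs →
    sum (map f (concatMap g xs)) ≡ sum (map (λ x → sum (map f (g x))) xs)
  sum-concatMap f g []       = refl
  sum-concatMap f g (x ∷ xs) = begin
    sum (map f (g x ++ concatMap g xs))                ≡⟨ cong sum (map-++ f (g x) _) ⟩
    sum (map f (g x) ++ map f (concatMap g xs))        ≡⟨ sum-++ (map f (g x)) _ ⟩
    sum (map f (g x)) + sum (map f (concatMap g xs))   ≡⟨ cong (sum (map f (g x)) +_) (sum-concatMap f g xs) ⟩
    _                                                  ∎
    where open ≡-Reasoning

  insSum*-permutations : ∀ (xs : List A) f → sum (map f (permutations xs)) ≡ insSum* xs f []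
  insSum*-permutations []       f = +-identityʳ _
  insSum*-permutations (x ∷ xs) f = begin
    sum (map f (concatMap (insertions x) (permutations xs)))
      ≡⟨ sum-concatMap f (insertions x) (permutations xs) ⟩
    sum (map (λ p → sum (map f (insertions x p))) (permutations xs))
      ≡⟨ cong sum (map-cong (insSum-insertions x f) (permutations xs)) ⟩
    sum (map (insSum x f) (permutations xs))
      ≡⟨ insSum*-permutations xs (insSum x f) ⟩
    insSum* xs (insSum x f) [] ∎
    where open ≡-Reasoning

  insSum*-++ : ∀ (xs ys : List A) f → insSum* (xs ++ ys) f ≡ insSum* ys (insSum* xs f)
  insSum*-++ []       ys f = refl
  insSum*-++ (x ∷ xs) ys f = insSum*-++ xs ys (insSum x f)

  -- The set `S` lets a comparison assume that the list built so far avoids a given block, or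
  -- contains no block vertex at all.
  insSum-mono-on : ∀ {S : Pred A 0ℓ} {x : A} {f g} → S x → (∀ {q} → All S q → f q ≤ g q) →
    ∀ {p} → All S p → insSum x f p ≤ insSum x g p
  insSum-mono-on sx f≤g []         = f≤g (sx ∷ [])
  insSum-mono-on sx f≤g (sy ∷ sys) =
    +-mono-≤ (f≤g (sx ∷ sy ∷ sys)) (insSum-mono-on sx (λ sq → f≤g (sy ∷ sq)) sys)

  insSum*-mono-on : ∀ {S : Pred A 0ℓ} {xs : List A} {f g} → All S xs → (∀ {q} → All S q → f q ≤ g q) →
    ∀ {p} → All S p → insSum* xs f p ≤ insSum* xs g p
  insSum*-mono-on []         f≤g sp = f≤g sp
  insSum*-mono-on (sx ∷ sxs) f≤g sp = insSum*-mono-on sxs (insSum-mono-on sx f≤g) sp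

  insSum*-mono : ∀ (xs : List A) {f g} → (∀ q → f q ≤ g q) → ∀ p → insSum* xs f p ≤ insSum* xs g p
  insSum*-mono xs f≤g p =
    insSum*-mono-on {S = λ _ → ⊤} (universal _ xs) (λ {q} _ → f≤g q) (universal _ p)

  insSum*-cong : ∀ (xs : List A) {f g} → f ≗ g → insSum* xs f ≗ insSum* xs g
  insSum*-cong xs f≗g p = ≤-antisym (insSum*-mono xs (λ q → ≤-reflexive (f≗g q)) p)
                                    (insSum*-mono xs (λ q → ≤-reflexive (sym (f≗g q))) p)

  insSum-+ : ∀ (x : A) f g p → insSum x (λ q → f q + g q) p ≡ insSum x f p + insSum x g p
  insSum-+ x f g []       = refl
  insSum-+ x f g (y ∷ ys) = trans (cong (f (x ∷ y ∷ ys) + g (x ∷ y ∷ ys) +_) (insSum-+ x (f ∘ (y ∷_)) (g ∘ (y ∷_)) ys))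
    (swap (f (x ∷ y ∷ ys)) _ _ _)
    where
    swap : ∀ a b c d → a + b + (c + d) ≡ a + c + (b + d)
    swap = solve-∀

  insSum*-+ : ∀ (xs : List A) f g p → insSum* xs (λ q → f q + g q) p ≡ insSum* xs f p + insSum* xs g p
  insSum*-+ []       f g p = refl
  insSum*-+ (x ∷ xs) f g p =
    trans (insSum*-cong xs (insSum-+ x f g) p) (insSum*-+ xs (insSum x f) (insSum x g) p)

  -- All lists produced have the same length, so a factor that depends only on the length comes out
  -- of the sum. This is the form in which independence is used.
  insSum-scale : ∀ (x : A) (φ : ℕ → ℕ) f p →
    insSum x (λ q → φ (length q) * f q) p ≡ φ (suc (length p)) * insSum x f p
  insSum-scale x φ f []       = refl
  insSum-scale x φ f (y ∷ ys) =
    trans (cong (φ (suc (suc (length ys))) * f (x ∷ y ∷ ys) +_) (insSum-scale x (φ ∘ suc) (f ∘ (y ∷_)) ys))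
          (sym (*-distribˡ-+ (φ (suc (suc (length ys)))) (f (x ∷ y ∷ ys)) _))

  insSum*-scale : ∀ (xs : List A) (φ : ℕ → ℕ) f p →
    insSum* xs (λ q → φ (length q) * f q) p ≡ φ (length xs + length p) * insSum* xs f p
  insSum*-scale []       φ f p = refl
  insSum*-scale (x ∷ xs) φ f p =
    trans (insSum*-cong xs (insSum-scale x φ f) p) (insSum*-scale xs (φ ∘ suc) (insSum x f) p)

  Ignores : (List A → ℕ) → Pred A 0ℓ
  Ignores f x = ∀ ys zs → f (ys ++ x ∷ zs) ≡ f (ys ++ zs)

  insSum-ignored : ∀ {f} {x : A} → Ignores f x → ∀ p → insSum x f p ≡ suc (length p) * f p
  insSum-ignored ign []       = trans (ign [] []) (sym (+-identityʳ _))
  insSum-ignored ign (y ∷ ys) =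
    cong₂ _+_ (ign [] (y ∷ ys)) (insSum-ignored (λ us vs → ign (y ∷ us) vs) ys)

  -- The rising factorial (t + 1) ... (t + j): the number of ways to insert j entries, one after
  -- another, into a list of length t.
  rising : ℕ → ℕ → ℕ
  rising zero    t = 1
  rising (suc j) t = suc (j + t) * rising j t

  insSum*-ignored : ∀ {f} {xs : List A} → All (Ignores f) xs → ∀ p →
    insSum* xs f p ≡ rising (length xs) (length p) * f p
  insSum*-ignored                  []           p = sym (+-identityʳ _)
  insSum*-ignored {f = f} {x ∷ xs} (ign ∷ igns) p = begin
    insSum* xs (insSum x f) p                        ≡⟨ insSum*-cong xs (insSum-ignored ign) p ⟩
    insSum* xs (λ q → suc (length q) * f q) p        ≡⟨ insSum*-scale xs suc f p ⟩
    suc (l + length p) * insSum* xs f p              ≡⟨ cong (suc (l + length p) *_) (insSum*-ignored igns p) ⟩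
    suc (l + length p) * (rising l (length p) * f p) ≡⟨ *-assoc (suc (l + length p)) (rising l (length p)) (f p) ⟨
    rising (suc l) (length p) * f p                  ∎
    where
    open ≡-Reasoning
    l = length xs

  insSum*-1 : ∀ (xs p : List A) → insSum* xs (const 1) p ≡ rising (length xs) (length p)
  insSum*-1 xs p = trans (insSum*-ignored (universal (λ _ _ _ → refl) xs) p) (*-identityʳ _)

  rising-! : ∀ j t → rising j t * t ! ≡ (j + t) !
  rising-! zero    t = +-identityʳ _
  rising-! (suc j) t = trans (*-assoc (suc (j + t)) (rising j t) (t !)) (cong (suc (j + t) *_) (rising-! j t))

  rising-+ : ∀ i j t → rising (i + j) t ≡ rising i (j + t) * rising j t
  rising-+ zero    j t = sym (+-identityʳ _)
  rising-+ (suc i) j t = begin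
    suc (i + j + t) * rising (i + j) t                ≡⟨ cong₂ _*_ (cong suc (+-assoc i j t)) (rising-+ i j t) ⟩
    suc (i + (j + t)) * (rising i (j + t) * rising j t) ≡⟨ *-assoc (suc (i + (j + t))) (rising i (j + t)) (rising j t) ⟨
    _ ∎
    where open ≡-Reasoning

  rising-shift : ∀ j t → suc t * rising j (suc t) ≡ rising (suc j) t
  rising-shift zero    t = refl
  rising-shift (suc j) t = begin
    suc t * (suc (j + suc t) * rising j (suc t)) ≡⟨ *-swapˡ (suc t) (suc (j + suc t)) (rising j (suc t)) ⟩
    suc (j + suc t) * (suc t * rising j (suc t)) ≡⟨ cong₂ (λ a b → suc a * b) (+-suc j t) (rising-shift j t) ⟩
    _ ∎
    where
    open ≡-Reasoning

  -- Iterated prefix sums and binomial coefficients.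

  prefixSum : (ℕ → ℕ) → ℕ → ℕ
  prefixSum φ zero    = φ 0
  prefixSum φ (suc t) = φ 0 + prefixSum (φ ∘ suc) t

  prefixSum-suc : ∀ φ t → prefixSum φ (suc t) ≡ prefixSum φ t + φ (suc t)
  prefixSum-suc φ zero    = refl
  prefixSum-suc φ (suc t) =
    trans (cong (φ 0 +_) (prefixSum-suc (φ ∘ suc) t)) (sym (+-assoc (φ 0) _ _))

  prefixSum-* : ∀ a φ t → prefixSum (λ s → a * φ s) t ≡ a * prefixSum φ t
  prefixSum-* a φ zero    = refl
  prefixSum-* a φ (suc t) =
    trans (cong (a * φ 0 +_) (prefixSum-* a (φ ∘ suc) t)) (sym (*-distribˡ-+ a (φ 0) _))

  prefixSum-cong : ∀ {φ ψ} → φ ≗ ψ → prefixSum φ ≗ prefixSum ψ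
  prefixSum-cong φ≗ψ zero    = φ≗ψ 0
  prefixSum-cong φ≗ψ (suc t) = cong₂ _+_ (φ≗ψ 0) (prefixSum-cong (φ≗ψ ∘ suc) t)

  -- The hockey-stick identity with denominators cleared: `rising j t` is j! times the binomial
  -- coefficient of j + t over j.
  prefixSum-rising : ∀ j t → suc j * prefixSum (rising j) t ≡ rising (suc j) t
  prefixSum-rising j zero    = cong (λ a → suc a * rising j 0) (sym (+-identityʳ j))
  prefixSum-rising j (suc t) = begin
    suc j * prefixSum (rising j) (suc t)
      ≡⟨ cong (suc j *_) (prefixSum-suc (rising j) t) ⟩
    suc j * (prefixSum (rising j) t + r)
      ≡⟨ *-distribˡ-+ (suc j) (prefixSum (rising j) t) r ⟩
    suc j * prefixSum (rising j) t + suc j * r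
      ≡⟨ cong (_+ suc j * r) (trans (prefixSum-rising j t) (sym (rising-shift j t))) ⟩
    suc t * r + suc j * r
      ≡⟨ collect j t r ⟩
    suc (j + suc t) * r ∎
    where
    open ≡-Reasoning
    r = rising j (suc t)
    collect : ∀ j t r → suc t * r + suc j * r ≡ suc (j + suc t) * r
    collect = solve-∀

  prefixSums : ℕ → (ℕ → ℕ) → ℕ → ℕ
  prefixSums zero    φ = φ
  prefixSums (suc m) φ = prefixSum (prefixSums m φ)

  -- `prefixSums` adds a new sum on the outside, whereas the induction in `weight-insert*` produces
  -- it on the inside.
  prefixSums-comm : ∀ m φ → prefixSums m (prefixSum φ) ≡ prefixSum (prefixSums m φ)
  prefixSums-comm zero    φ = refl
  prefixSums-comm (suc m) φ = cong prefixSum (prefixSums-comm m φ)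

  -- The m-fold prefix sum of 1 is the binomial coefficient of m + t over m, which counts the ways
  -- to merge m entries in a prescribed order with t others.
  prefixSums-1 : ∀ m t → m ! * prefixSums m (const 1) t ≡ rising m t
  prefixSums-1 zero    t = refl
  prefixSums-1 (suc m) t = begin
    suc m * m ! * prefixSum ψ t             ≡⟨ *-assoc (suc m) (m !) _ ⟩
    suc m * (m ! * prefixSum ψ t)           ≡⟨ cong (suc m *_) (prefixSum-* (m !) ψ t) ⟨
    suc m * prefixSum (λ s → m ! * ψ s) t   ≡⟨ cong (suc m *_) (prefixSum-cong (prefixSums-1 m) t) ⟩
    suc m * prefixSum (rising m) t          ≡⟨ prefixSum-rising m t ⟩
    rising (suc m) t                        ∎
    where
    open ≡-Reasoning
    ψ = prefixSums m (const 1)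

  𝟙 : ∀ {X : Set} → Dec X → ℕ
  𝟙 d = if does d then 1 else 0

  𝟙-mono : ∀ {X Y : Set} {d : Dec X} {e : Dec Y} → (X → Y) → 𝟙 d ≤ 𝟙 e
  𝟙-mono {d = no _}              _   = z≤n
  𝟙-mono {d = yes _} {e = yes _} _   = ≤-refl
  𝟙-mono {d = yes x} {e = no ¬y} x→y = contradiction (x→y x) ¬y

  𝟙≤1 : ∀ {X : Set} (d : Dec X) → 𝟙 d ≤ 1
  𝟙≤1 (yes _) = ≤-refl
  𝟙≤1 (no _)  = z≤n

  rising-0 : ∀ j → rising j 0 ≡ j !
  rising-0 j = trans (sym (*-identityʳ _)) (trans (rising-! j 0) (cong _! (+-identityʳ j)))

  insSum*-const : ∀ (xs : List A) c → insSum* xs (const c) [] ≡ c * length xs !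
  insSum*-const xs c = begin
    insSum* xs (const c) []          ≡⟨ insSum*-cong xs (λ _ → sym (*-identityʳ c)) [] ⟩
    insSum* xs (const (c * 1)) []    ≡⟨ insSum*-scale xs (const c) (const 1) [] ⟩
    c * insSum* xs (const 1) []      ≡⟨ cong (c *_) (trans (insSum*-1 xs []) (rising-0 (length xs))) ⟩
    c * length xs !                  ∎
    where open ≡-Reasoning

  -- The insertions that put something in front of `y` are discarded.
  insSum*-front : ∀ (xs : List A) f y p → insSum* xs (f ∘ (y ∷_)) p ≤ insSum* xs f (y ∷ p)
  insSum*-front []       f y p = ≤-refl
  insSum*-front (x ∷ xs) f y p =
    ≤-trans (insSum*-mono xs (λ q → m≤n+m (insSum x (f ∘ (y ∷_)) q) (f (x ∷ y ∷ q))) p)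
            (insSum*-front xs (insSum x f) y p)

  -- The first two entries of an ordering.

  module Heads (a b : A → ℕ) where

    first : (A → ℕ) → List A → ℕ
    first w []      = 0
    first w (x ∷ _) = w x

    firstTwo : List A → ℕ
    firstTwo (x ∷ y ∷ _) = a x * b y
    firstTwo _           = 0

    insSum-const : ∀ (x : A) c p → insSum x (const c) p ≡ suc (length p) * c
    insSum-const x c p = insSum-ignored (λ _ _ → refl) p

    insSum-first : ∀ w x p → insSum x (first w) p ≡ w x + length p * first w p
    insSum-first w x []       = sym (+-identityʳ _)
    insSum-first w x (y ∷ ys) = cong (w x +_) (insSum-const x (w y) ys)

    -- The three terms are the insertions of `x` in first place, in second place, and behind. The
    -- truncated subtraction is harmless for the empty list, where `firstTwo` is 0.
    insSum-firstTwo : ∀ x p →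
      insSum x firstTwo p ≡ a x * first b p + (b x * first a p + (length p ∸ 1) * firstTwo p)
    insSum-firstTwo x []           = sym (cong₂ _+_ (*-zeroʳ (a x)) (trans (+-identityʳ _) (*-zeroʳ (b x))))
    insSum-firstTwo x (y ∷ [])     = cong (a x * b y +_) (trans (*-comm (a y) (b x)) (sym (+-identityʳ _)))
    insSum-firstTwo x (y ∷ z ∷ zs) =
      cong (a x * b y +_) (cong₂ _+_ (*-comm (a y) (b x)) (insSum-const x (a y * b z) zs))

    total : (A → ℕ) → List A → ℕ
    total w xs = sum (map w xs)

    insSum*-first : ∀ w x xs → insSum* (x ∷ xs) (first w) [] ≡ total w (x ∷ xs) * length xs !
    insSum*-first w x xs = begin
      insSum* xs (insSum x (first w)) []
        ≡⟨ insSum*-cong xs (insSum-first w x) [] ⟩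
      insSum* xs (λ p → w x + length p * first w p) []
        ≡⟨ insSum*-+ xs (const (w x)) _ [] ⟩
      insSum* xs (const (w x)) [] + insSum* xs (λ p → length p * first w p) []
        ≡⟨ cong₂ _+_ (insSum*-const xs (w x)) (rest xs) ⟩
      w x * length xs ! + total w xs * length xs !
        ≡⟨ *-distribʳ-+ (length xs !) (w x) _ ⟨
      total w (x ∷ xs) * length xs ! ∎
      where
      open ≡-Reasoning
      rest : ∀ xs → insSum* xs (λ p → length p * first w p) [] ≡ total w xs * length xs !
      rest []       = refl
      rest (y ∷ ys) = begin
        insSum* (y ∷ ys) (λ p → length p * first w p) []
          ≡⟨ insSum*-scale (y ∷ ys) (λ l → l) (first w) [] ⟩
        (suc (length ys) + 0) * insSum* (y ∷ ys) (first w) []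
          ≡⟨ cong₂ _*_ (+-identityʳ (suc (length ys))) (insSum*-first w y ys) ⟩
        suc (length ys) * (total w (y ∷ ys) * length ys !)
          ≡⟨ *-swapˡ (suc (length ys)) (total w (y ∷ ys)) (length ys !) ⟩
        total w (y ∷ ys) * (suc (length ys) * length ys !) ∎

    -- Each ordered pair of different places in the list can be put in front, with `length ys !`
    -- orders for the rest. The hypothesis makes the diagonal terms vanish, so that they may be
    -- added and the sum over pairs factors into the two totals.
    insSum*-firstTwo : (∀ x → a x * b x ≡ 0) → ∀ x y ys → let xs = x ∷ y ∷ ys in
      insSum* xs firstTwo [] ≡ total a xs * total b xs * length ys !
    insSum*-firstTwo ab≡0 x y ys = begin
      insSum* (y ∷ ys) (insSum x firstTwo) []
        ≡⟨ insSum*-cong (y ∷ ys) (insSum-firstTwo x) [] ⟩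
      insSum* (y ∷ ys) (λ p → a x * first b p + (b x * first a p + (length p ∸ 1) * firstTwo p)) []
        ≡⟨ insSum*-+ (y ∷ ys) _ _ [] ⟩
      insSum* (y ∷ ys) (λ p → a x * first b p) [] +
        insSum* (y ∷ ys) (λ p → b x * first a p + (length p ∸ 1) * firstTwo p) []
        ≡⟨ cong₂ _+_ (insSum*-scale (y ∷ ys) (const (a x)) (first b) []) (insSum*-+ (y ∷ ys) _ _ []) ⟩
      a x * insSum* (y ∷ ys) (first b) [] +
        (insSum* (y ∷ ys) (λ p → b x * first a p) [] + insSum* (y ∷ ys) (λ p → (length p ∸ 1) * firstTwo p) [])
        ≡⟨ cong₂ _+_ (cong (a x *_) (insSum*-first b y ys))
             (cong₂ _+_ (trans (insSum*-scale (y ∷ ys) (const (b x)) (first a) []) (cong (b x *_) (insSum*-first a y ys)))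
                        (trans (insSum*-scale (y ∷ ys) (_∸ 1) firstTwo [])
                               (cong (_* insSum* (y ∷ ys) firstTwo []) (+-identityʳ (length ys))))) ⟩
      a x * (β * l !) + (b x * (α * l !) + l * insSum* (y ∷ ys) firstTwo [])
        ≡⟨ cong (λ h → a x * (β * l !) + (b x * (α * l !) + h)) (rest y ys) ⟩
      a x * (β * l !) + (b x * (α * l !) + α * β * l !)
        ≡⟨ collect (a x) (b x) α β (l !) ⟩
      a x * (β * l !) + (b x * (α * l !) + α * β * l !) + 0 * l !
        ≡⟨ cong (λ z → a x * (β * l !) + (b x * (α * l !) + α * β * l !) + z * l !) (ab≡0 x) ⟨
      a x * (β * l !) + (b x * (α * l !) + α * β * l !) + a x * b x * l !
        ≡⟨ expand (a x) (b x) α β (l !) ⟩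
      (a x + α) * (b x + β) * l ! ∎
      where
      open ≡-Reasoning
      l = length ys
      α = total a (y ∷ ys)
      β = total b (y ∷ ys)
      collect : ∀ p q α β f → p * (β * f) + (q * (α * f) + α * β * f) ≡ p * (β * f) + (q * (α * f) + α * β * f) + 0 * f
      collect = solve-∀
      expand : ∀ p q α β f → p * (β * f) + (q * (α * f) + α * β * f) + p * q * f ≡ (p + α) * (q + β) * f
      expand = solve-∀
      swap : ∀ a b c d → a * (b * c * d) ≡ b * c * (a * d)
      swap = solve-∀
      rest : ∀ y ys → length ys * insSum* (y ∷ ys) firstTwo [] ≡ total a (y ∷ ys) * total b (y ∷ ys) * length ys !
      rest y [] = begin
        0                                  ≡⟨ ab≡0 y ⟨
        a y * b y                          ≡⟨ cong₂ _*_ (+-identityʳ (a y)) (+-identityʳ (b y)) ⟨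
        (a y + 0) * (b y + 0)              ≡⟨ *-identityʳ _ ⟨
        (a y + 0) * (b y + 0) * 1          ∎
      rest y (z ∷ zs) = begin
        suc (length zs) * insSum* (y ∷ z ∷ zs) firstTwo []
          ≡⟨ cong (suc (length zs) *_) (insSum*-firstTwo ab≡0 y z zs) ⟩
        suc (length zs) * (total a (y ∷ z ∷ zs) * total b (y ∷ z ∷ zs) * length zs !)
          ≡⟨ swap (suc (length zs)) (total a (y ∷ z ∷ zs)) _ (length zs !) ⟩
        total a (y ∷ z ∷ zs) * total b (y ∷ z ∷ zs) * (suc (length zs) * length zs !) ∎

  -- The first two terms of the binomial expansion. For `n` equal to `μ` this bounds (μ / (μ + 1)) ^
  -- (μ + 1) by one half.
  bernoulli : ∀ μ n → μ ^ suc n + suc n * μ ^ n ≤ suc μ ^ suc n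
  bernoulli μ zero    = ≤-reflexive (base μ)
    where
    base : ∀ μ → μ * 1 + 1 ≡ 1 + μ * 1
    base = solve-∀
  bernoulli μ (suc n) = begin
    μ * (μ * μ ^ n) + suc (suc n) * (μ * μ ^ n)                   ≤⟨ m≤m+n _ (suc n * μ ^ n) ⟩
    μ * (μ * μ ^ n) + suc (suc n) * (μ * μ ^ n) + suc n * μ ^ n   ≡⟨ factor μ n (μ ^ n) ⟩
    suc μ * (μ * μ ^ n + suc n * μ ^ n)                           ≤⟨ *-monoʳ-≤ (suc μ) (bernoulli μ n) ⟩
    suc μ * suc μ ^ suc n                                         ∎
    where
    open ≤-Reasoning
    factor : ∀ μ n x → μ * (μ * x) + suc (suc n) * (μ * x) + suc n * x ≡ suc μ * (μ * x + suc n * x)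
    factor = solve-∀

  -- The chance that one set of entries arrives in a prescribed order.

  module Pattern (_≟_ : DecidableEquality A) {P : Pred A 0ℓ} (P? : Decidable P) where

    lead : List A → ℕ
    lead []       = 0
    lead (y ∷ ys) = if does (P? y) then 0 else suc (lead ys)

    occurs : List A → List A → ℕ
    occurs D q = 𝟙 (≡-dec _≟_ (filter P? q) D)

    -- A pattern is inserted from its last entry to its first, and the favourable places for the
    -- next entry number one more than `lead`. The induction therefore has to carry an arbitrary
    -- function `φ` of `lead`.
    weight : (ℕ → ℕ) → List A → List A → ℕ
    weight φ D q = occurs D q * φ (lead q)

    lead-accept : ∀ {y} ys → P y → lead (y ∷ ys) ≡ 0
    lead-accept {y} ys py rewrite dec-true (P? y) py = refl

    lead-reject : ∀ {y} ys → ¬ P y → lead (y ∷ ys) ≡ suc (lead ys)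
    lead-reject {y} ys ¬py rewrite dec-false (P? y) ¬py = refl

    lead-none : ∀ {p} → All (¬_ ∘ P) p → lead p ≡ length p
    lead-none []                       = refl
    lead-none {p = y ∷ ys} (¬py ∷ ¬pys) = trans (lead-reject ys ¬py) (cong suc (lead-none ¬pys))

    occurs-reject : ∀ {y} D ys → ¬ P y → occurs D (y ∷ ys) ≡ occurs D ys
    occurs-reject D ys ¬py = cong (λ zs → 𝟙 (≡-dec _≟_ zs D)) (filter-reject P? ¬py)

    weight-reject : ∀ {y} φ D ys → ¬ P y → weight φ D (y ∷ ys) ≡ weight (φ ∘ suc) D ys
    weight-reject φ D ys ¬py = cong₂ (λ a b → a * φ b) (occurs-reject D ys ¬py) (lead-reject ys ¬py)

    weight-front : ∀ {c} → P c → ∀ φ D q → occurs D q * φ 0 ≤ weight φ (c ∷ D) (c ∷ q)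
    weight-front {c} pc φ D q
      rewrite filter-accept P? {xs = q} pc | lead-accept q pc =
      *-monoˡ-≤ (φ 0) (𝟙-mono {d = ≡-dec _≟_ (filter P? q) D}
                              {e = ≡-dec _≟_ (c ∷ filter P? q) (c ∷ D)} (cong (c ∷_)))

    -- A new first element c of the pattern may go to any of the lead q + 1
    -- places in front of the pattern elements already there.
    weight-insert : ∀ {c} → P c → ∀ φ D q → weight (prefixSum φ) D q ≤ insSum c (weight φ (c ∷ D)) q
    weight-insert pc φ D [] = weight-front pc φ D []
    weight-insert {c} pc φ D (y ∷ ys) = go (P? y)
      where
      open ≤-Reasoning
      go : Dec (P y) → weight (prefixSum φ) D (y ∷ ys) ≤ insSum c (weight φ (c ∷ D)) (y ∷ ys)
      go (yes py) = begin
        weight (prefixSum φ) D (y ∷ ys)          ≡⟨ cong (λ t → occurs D (y ∷ ys) * prefixSum φ t) (lead-accept ys py) ⟩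
        occurs D (y ∷ ys) * φ 0                  ≤⟨ weight-front pc φ D (y ∷ ys) ⟩
        weight φ (c ∷ D) (c ∷ y ∷ ys)            ≤⟨ m≤m+n _ _ ⟩
        insSum c (weight φ (c ∷ D)) (y ∷ ys)     ∎
      go (no ¬py) = begin
        weight (prefixSum φ) D (y ∷ ys)
          ≡⟨ weight-reject (prefixSum φ) D ys ¬py ⟩
        occurs D ys * (φ 0 + prefixSum (φ ∘ suc) (lead ys))
          ≡⟨ *-distribˡ-+ (occurs D ys) (φ 0) _ ⟩
        occurs D ys * φ 0 + weight (prefixSum (φ ∘ suc)) D ys
          ≡⟨ cong (λ a → a * φ 0 + weight (prefixSum (φ ∘ suc)) D ys) (occurs-reject D ys ¬py) ⟨
        occurs D (y ∷ ys) * φ 0 + weight (prefixSum (φ ∘ suc)) D ys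
          ≤⟨ +-mono-≤ (weight-front pc φ D (y ∷ ys)) (weight-insert pc (φ ∘ suc) D ys) ⟩
        weight φ (c ∷ D) (c ∷ y ∷ ys) + insSum c (weight (φ ∘ suc) (c ∷ D)) ys
          ≡⟨ cong (weight φ (c ∷ D) (c ∷ y ∷ ys) +_)
                  (insSum*-cong (c ∷ []) (λ zs → sym (weight-reject φ (c ∷ D) zs ¬py)) ys) ⟩
        insSum c (weight φ (c ∷ D)) (y ∷ ys) ∎

    weight-insert* : ∀ {C} → All P C → ∀ φ p →
      weight (prefixSums (length C) φ) [] p ≤ insSum* C (weight φ C) p
    weight-insert*              []         φ p = ≤-refl
    weight-insert* {C = c ∷ D} (pc ∷ pcs) φ p = begin
      weight (prefixSums (suc (length D)) φ) [] p     ≡⟨ cong (λ ψ → weight ψ [] p) (prefixSums-comm (length D) φ) ⟨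
      weight (prefixSums (length D) (prefixSum φ)) [] p ≤⟨ weight-insert* pcs (prefixSum φ) p ⟩
      insSum* D (weight (prefixSum φ) D) p            ≤⟨ insSum*-mono D (weight-insert pc φ D) p ⟩
      insSum* D (insSum c (weight φ (c ∷ D))) p       ∎
      where open ≤-Reasoning

    -- At the start no pattern entry is present, so `lead p` is the whole length and the m-fold
    -- prefix sum of 1 counts the favourable insertions. They make up a fraction of at least 1/m! of
    -- all.
    occurs-insert* : ∀ {C} → All P C → ∀ {p} → All (¬_ ∘ P) p →
      rising (length C) (length p) ≤ length C ! * insSum* C (occurs C) p
    occurs-insert* {C} pcs {p} ¬ps = begin
      rising m (length p)                          ≡⟨ prefixSums-1 m (length p) ⟨
      m ! * ψ (length p)                           ≡⟨ cong (m ! *_) p-weight ⟨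
      m ! * weight ψ [] p                          ≤⟨ *-monoʳ-≤ (m !) (weight-insert* pcs (const 1) p) ⟩
      m ! * insSum* C (weight (const 1) C) p       ≡⟨ cong (m ! *_) (insSum*-cong C (λ q → *-identityʳ _) p) ⟩
      m ! * insSum* C (occurs C) p                 ∎
      where
      open ≤-Reasoning
      m = length C
      ψ = prefixSums m (const 1)
      p-weight : weight ψ [] p ≡ ψ (length p)
      p-weight rewrite filter-none P? ¬ps | lead-none ¬ps = +-identityʳ _

  -- Many disjoint patterns: at least one of them occurs.

  module Patterns {ℛ : Set} (_≟_ : DecidableEquality A) (P : ℛ → Pred A 0ℓ) (P? : ∀ r → Decidable (P r))
    (C : ℛ → List A) (m : ℕ) (length-C : ∀ r → length (C r) ≡ m)
    (P-C : ∀ r → All (P r) (C r)) (P-disjoint : ∀ {r r′} → r ≢ r′ → ∀ {x} → P r x → ¬ P r′ x) where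

    open module Pat r = Pattern _≟_ (P? r) using (occurs; occurs-insert*)

    someOccurs : List ℛ → List A → ℕ
    someOccurs []       q = 0
    someOccurs (r ∷ rs) q = occurs r (C r) q ⊔ someOccurs rs q

    someOccurs≤1 : ∀ rs q → someOccurs rs q ≤ 1
    someOccurs≤1 []       q = z≤n
    someOccurs≤1 (r ∷ rs) q = ⊔-lub (𝟙≤1 (≡-dec _≟_ (filter (P? r) q) (C r))) (someOccurs≤1 rs q)

    someOccurs-bound : ∀ {q a b} rs → (∀ r → filter (P? r) q ≡ C r → a ≤ b) → a * someOccurs rs q ≤ b
    someOccurs-bound {a = a} []       h = ≤-trans (≤-reflexive (*-zeroʳ a)) z≤n
    someOccurs-bound {q} {a} {b} (r ∷ rs) h = begin
      a * (occurs r (C r) q ⊔ someOccurs rs q)       ≡⟨ *-distribˡ-⊔ a (occurs r (C r) q) (someOccurs rs q) ⟩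
      a * occurs r (C r) q ⊔ a * someOccurs rs q     ≤⟨ ⊔-lub (here (≡-dec _≟_ (filter (P? r) q) (C r))) (someOccurs-bound rs h) ⟩
      b                                              ∎
      where
      open ≤-Reasoning
      here : (d : Dec (filter (P? r) q ≡ C r)) → a * 𝟙 d ≤ b
      here (yes eq) = ≤-trans (≤-reflexive (*-identityʳ a)) (h r eq)
      here (no _)   = ≤-trans (≤-reflexive (*-zeroʳ a)) z≤n

    someOccurs-ignores : ∀ {rs x} → All (λ r → ¬ P r x) rs → Ignores (someOccurs rs) x
    someOccurs-ignores                  []           ys zs = refl
    someOccurs-ignores {rs = r ∷ rs} {x} (¬px ∷ ¬pxs) ys zs =
      cong₂ _⊔_ (cong (λ us → 𝟙 (≡-dec _≟_ us (C r))) eq) (someOccurs-ignores ¬pxs ys zs)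
      where
      eq : filter (P? r) (ys ++ x ∷ zs) ≡ filter (P? r) (ys ++ zs)
      eq = begin
        filter (P? r) (ys ++ x ∷ zs)               ≡⟨ filter-++ (P? r) ys (x ∷ zs) ⟩
        filter (P? r) ys ++ filter (P? r) (x ∷ zs) ≡⟨ cong (filter (P? r) ys ++_) (filter-reject (P? r) ¬px) ⟩
        filter (P? r) ys ++ filter (P? r) zs       ≡⟨ filter-++ (P? r) ys zs ⟨
        filter (P? r) (ys ++ zs)                   ∎
        where open ≡-Reasoning

    patterns : List ℛ → List A
    patterns = concatMap C

    length-patterns : ∀ rs → length (patterns rs) ≡ length rs * m
    length-patterns []       = refl
    length-patterns (r ∷ rs) = trans (length-++ (C r)) (cong₂ _+_ (length-C r) (length-patterns rs))

    patterns-miss : ∀ {r rs} → All (r ≢_) rs → All (¬_ ∘ P r) (patterns rs)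
    patterns-miss []           = []
    patterns-miss (r≢r′ ∷ r≢s) =
      All.++⁺ (All.map (P-disjoint (r≢r′ ∘ sym)) (P-C _)) (patterns-miss r≢s)

    -- If no earlier pattern occurs in `q`, the new one does for a fraction of at least 1 / (μ + 1)
    -- of its insertions; if one occurs, it survives all of them. The affine function (μ s + 1) / (μ
    -- + 1) of the indicator s covers both cases, and being affine it can be summed over `q`.
    someOccurs-insert : ∀ {r rs} → All (r ≢_) rs → ∀ {q} → All (¬_ ∘ P r) q → ∀ {μ} → suc μ ≡ m ! →
      rising m (length q) * (μ * someOccurs rs q + 1) ≤ suc μ * insSum* (C r) (someOccurs (r ∷ rs)) q
    someOccurs-insert {r} {rs} r≢rs {q} ¬pq {μ} sucμ with someOccurs rs q in eq | someOccurs≤1 rs q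
    ... | zero | _ = begin
      rising m (length q) * (μ * 0 + 1)
        ≡⟨ trans (cong (λ a → rising m (length q) * (a + 1)) (*-zeroʳ μ)) (*-identityʳ _) ⟩
      rising m (length q)
        ≤⟨ subst (λ l → rising l (length q) ≤ l ! * insSum* (C r) (occurs r (C r)) q) (length-C r) (occurs-insert* r (P-C r) ¬pq) ⟩
      m ! * insSum* (C r) (occurs r (C r)) q
        ≤⟨ *-mono-≤ (≤-reflexive (sym sucμ)) (insSum*-mono (C r) (λ q′ → m≤m⊔n _ (someOccurs rs q′)) q) ⟩
      suc μ * insSum* (C r) (someOccurs (r ∷ rs)) q ∎
      where open ≤-Reasoning
    ... | suc zero | _ = begin
      rising m (length q) * (μ * 1 + 1)
        ≡⟨ swap (rising m (length q)) μ ⟩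
      suc μ * (rising m (length q) * 1)
        ≡⟨ cong (suc μ *_) (cong₂ (λ l o → rising l (length q) * o) (length-C r) eq) ⟨
      suc μ * (rising (length (C r)) (length q) * someOccurs rs q)
        ≡⟨ cong (suc μ *_) (insSum*-ignored ignored q) ⟨
      suc μ * insSum* (C r) (someOccurs rs) q
        ≤⟨ *-monoʳ-≤ (suc μ) (insSum*-mono (C r) (λ q′ → m≤n⊔m _ (someOccurs rs q′)) q) ⟩
      suc μ * insSum* (C r) (someOccurs (r ∷ rs)) q ∎
      where
      open ≤-Reasoning
      swap : ∀ a b → a * (b * 1 + 1) ≡ suc b * (a * 1)
      swap = solve-∀
      ignored : All (Ignores (someOccurs rs)) (C r)
      ignored = All.map (λ px → someOccurs-ignores (All.map (λ r≢r′ → P-disjoint r≢r′ px) r≢rs)) (P-C r)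
    ... | suc (suc _) | s≤s ()

    -- Each of the l patterns fails independently with probability μ / (μ + 1).
    someOccurs-insert* : ∀ {rs} → Unique rs → ∀ {p} → All (λ r → All (¬_ ∘ P r) p) rs → ∀ {μ} → suc μ ≡ m ! →
      let l = length rs ; total = rising (l * m) (length p) in
      suc μ ^ l * total ≤ suc μ ^ l * insSum* (patterns rs) (someOccurs rs) p + μ ^ l * total
    someOccurs-insert* [] _ _ = ≤-refl
    someOccurs-insert* {r ∷ rs} (r≢rs ∷ uniq) {p} (¬p ∷ ¬ps) {μ} sucμ = begin
      M * M ^ l * rising (m + l * m) L        ≡⟨ cong (M * M ^ l *_) (rising-+ m (l * m) L) ⟩
      M * M ^ l * (t * T)                     ≡⟨ e₁ μ (M ^ l) t T ⟩
      μ * t * (M ^ l * T) + M ^ l * (t * T)   ≤⟨ +-monoˡ-≤ (M ^ l * (t * T)) (*-monoʳ-≤ (μ * t) (someOccurs-insert* uniq ¬ps sucμ)) ⟩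
      μ * t * (M ^ l * G + μ ^ l * T) + M ^ l * (t * T)
                                              ≡⟨ e₂ μ (M ^ l) (μ ^ l) t T G ⟩
      M ^ l * (t * (μ * G + T)) + μ * μ ^ l * (t * T)
                                              ≤⟨ +-monoˡ-≤ (μ * μ ^ l * (t * T)) (*-monoʳ-≤ (M ^ l) step) ⟩
      M ^ l * (M * G′) + μ * μ ^ l * (t * T)  ≡⟨ cong₂ _+_ (e₃ (M ^ l) M G′) (cong (μ * μ ^ l *_) (sym (rising-+ m (l * m) L))) ⟩
      M * M ^ l * G′ + μ * μ ^ l * rising (m + l * m) L ∎
      where
      open ≤-Reasoning
      M = suc μ
      l = length rs
      L = length p
      T = rising (l * m) L
      t = rising m (l * m + L)
      G = insSum* (patterns rs) (someOccurs rs) p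
      G′ = insSum* (C r ++ patterns rs) (someOccurs (r ∷ rs)) p
      e₁ : ∀ μ a t T → (a + μ * a) * (t * T) ≡ μ * t * (a * T) + a * (t * T)
      e₁ = solve-∀
      e₂ : ∀ μ a b t T G → μ * t * (a * G + b * T) + a * (t * T) ≡ a * (t * (μ * G + T)) + μ * b * (t * T)
      e₂ = solve-∀
      e₃ : ∀ a b c → a * (b * c) ≡ b * a * c
      e₃ = solve-∀

      total : insSum* (patterns rs) (const 1) p ≡ T
      total = trans (insSum*-1 (patterns rs) p) (cong (λ k → rising k L) (length-patterns rs))

      affine : insSum* (patterns rs) (λ q → μ * someOccurs rs q + 1) p ≡ μ * G + T
      affine = trans (insSum*-+ (patterns rs) _ (const 1) p)
                     (cong₂ _+_ (insSum*-scale (patterns rs) (const μ) (someOccurs rs) p) total)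

      pull : ∀ f → insSum* (patterns rs) (λ q → M * f q) p ≡ M * insSum* (patterns rs) f p
      pull f = insSum*-scale (patterns rs) (const M) f p

      -- The block of `r` is inserted after those of `rs`, into lists of the constant length
      -- `l * m + L`. Hence `t`, which counts its insertions, can be moved into the sum, where
      -- `someOccurs-insert` applies to each list.
      step : t * (μ * G + T) ≤ M * G′
      step = begin
        t * (μ * G + T)
          ≡⟨ cong₂ (λ k o → rising m (k + L) * o) (length-patterns rs) affine ⟨
        rising m (length (patterns rs) + L) * insSum* (patterns rs) (λ q → μ * someOccurs rs q + 1) p
          ≡⟨ insSum*-scale (patterns rs) (rising m) _ p ⟨
        insSum* (patterns rs) (λ q → rising m (length q) * (μ * someOccurs rs q + 1)) p
          ≤⟨ insSum*-mono-on (patterns-miss r≢rs) (λ ¬q → someOccurs-insert r≢rs ¬q sucμ) ¬p ⟩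
        insSum* (patterns rs) (λ q → M * insSum* (C r) (someOccurs (r ∷ rs)) q) p
          ≡⟨ pull (insSum* (C r) (someOccurs (r ∷ rs))) ⟩
        M * insSum* (patterns rs) (insSum* (C r) (someOccurs (r ∷ rs))) p
          ≡⟨ cong (λ h → M * h p) (insSum*-++ (C r) (patterns rs) (someOccurs (r ∷ rs))) ⟨
        M * G′ ∎

    someOccurs-half : ∀ {rs} → Unique rs → length rs ≡ m ! → ∀ {p} → All (λ r → All (¬_ ∘ P r) p) rs →
      rising (m ! * m) (length p) ≤ 2 * insSum* (patterns rs) (someOccurs rs) p
    someOccurs-half {rs} uniq len {p} ¬ps with m ! in sucμ | (m !≢0)
    ... | suc μ | _ = *-cancelˡ-≤ (M ^ M) {{m^n≢0 M M}} (+-cancelʳ-≤ (M ^ M * T) _ _ (begin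
      M ^ M * T + M ^ M * T                  ≡⟨ double (M ^ M * T) ⟩
      2 * (M ^ M * T)                        ≤⟨ *-monoʳ-≤ 2 bound ⟩
      2 * (M ^ M * G + μ ^ M * T)            ≡⟨ distr (M ^ M) G (μ ^ M) T ⟩
      M ^ M * (2 * G) + (μ ^ M + μ ^ M) * T  ≤⟨ +-monoʳ-≤ (M ^ M * (2 * G)) (*-monoˡ-≤ T 2μ^M≤M^M) ⟩
      M ^ M * (2 * G) + M ^ M * T            ∎))
      where
      open ≤-Reasoning
      M = suc μ
      T = rising (M * m) (length p)
      G = insSum* (patterns rs) (someOccurs rs) p
      double : ∀ x → x + x ≡ 2 * x
      double = solve-∀
      distr : ∀ a G b T → 2 * (a * G + b * T) ≡ a * (2 * G) + (b + b) * T
      distr = solve-∀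
      bound : M ^ M * T ≤ M ^ M * G + μ ^ M * T
      bound = subst (λ l → M ^ l * rising (l * m) (length p) ≤ M ^ l * G + μ ^ l * rising (l * m) (length p))
        len (someOccurs-insert* uniq ¬ps (sym sucμ))
      2μ^M≤M^M : μ ^ M + μ ^ M ≤ M ^ M
      -- In `bernoulli μ μ` the second term `M * μ ^ μ` unfolds to `μ ^ μ + μ ^ M`, which supplies
      -- the second copy of `μ ^ M`.
      2μ^M≤M^M = ≤-trans (+-monoʳ-≤ (μ ^ M) (m≤n+m (μ ^ M) (μ ^ μ))) (bernoulli μ μ)

    module _ (a b : A → ℕ) (ab≡0 : ∀ x → a x * b x ≡ 0) where
      open Heads a b

      -- The entries of `xs` are inserted first, and those of the patterns only behind the leading
      -- two; `someOccurs-half` then applies to what follows these two.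
      manyGoodOrders : ∀ {rs} → Unique rs → length rs ≡ m ! →
        ∀ {xs l} → length xs ≡ 2 + l → All (λ v → ∀ r → ¬ P r v) xs →
        ∀ {F k} → (∀ x y q → k * (a x * b y) * someOccurs rs q ≤ F (x ∷ y ∷ q)) →
        rising (m ! * m) l * (k * (total a xs * total b xs * l !))
          ≤ 2 * sum (map F (permutations (patterns rs ++ xs)))
      manyGoodOrders {rs} uniq len {xs@(x ∷ y ∷ zs)} refl ¬P-xs {F} {k} good≤F = begin
        T (length zs) * (k * (total a xs * total b xs * length zs !))
          ≡⟨ cong₂ (λ l w → T l * (k * w)) (+-identityʳ (length zs)) (insSum*-firstTwo ab≡0 x y zs) ⟨
        T (length zs + 0) * (k * insSum* xs firstTwo [])
          ≡⟨ cong (T (length zs + 0) *_) (insSum*-scale xs (const k) firstTwo []) ⟨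
        T (length zs + 0) * insSum* xs (λ p → k * firstTwo p) []
          -- Every `p` has the length of `xs`, so the constant factor may be read off from `p`: the
          -- pattern entries go into the part behind its first two entries, hence the subtraction of
          -- 2.
          ≡⟨ insSum*-scale xs (λ l → T (l ∸ 2)) (λ p → k * firstTwo p) [] ⟨
        insSum* xs (λ p → T (length p ∸ 2) * (k * firstTwo p)) []
          ≤⟨ insSum*-mono-on ¬P-xs pointwise [] ⟩
        insSum* xs (λ p → 2 * insSum* (patterns rs) F p) []
          ≡⟨ insSum*-scale xs (const 2) (insSum* (patterns rs) F) [] ⟩
        2 * insSum* xs (insSum* (patterns rs) F) []
          ≡⟨ cong (λ h → 2 * h []) (insSum*-++ (patterns rs) xs F) ⟨
        2 * insSum* (patterns rs ++ xs) F []
          ≡⟨ cong (2 *_) (insSum*-permutations (patterns rs ++ xs) F) ⟨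
        2 * sum (map F (permutations (patterns rs ++ xs))) ∎
        where
        open ≤-Reasoning
        T = rising (m ! * m)
        vanish : ∀ t k → t * (k * 0) ≡ 0
        vanish = solve-∀

        pointwise : ∀ {p} → All (λ v → ∀ r → ¬ P r v) p →
          T (length p ∸ 2) * (k * firstTwo p) ≤ 2 * insSum* (patterns rs) F p
        pointwise {[]}        _ = ≤-trans (≤-reflexive (vanish (T 0) k)) z≤n
        pointwise {_ ∷ []}    _ = ≤-trans (≤-reflexive (vanish (T 0) k)) z≤n
        pointwise {u ∷ v ∷ p} (_ ∷ _ ∷ ¬ps) = begin
          T (length p) * w
            ≤⟨ *-monoˡ-≤ w (someOccurs-half uniq len (All.tabulate (λ {r} _ → All.map (λ ¬P → ¬P r) ¬ps))) ⟩
          2 * G * w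
            ≡⟨ trans (*-comm (2 * G) w) (*-swapˡ w 2 G) ⟩
          2 * (w * G)
            ≡⟨ cong (2 *_) (insSum*-scale (patterns rs) (const w) (someOccurs rs) p) ⟨
          2 * insSum* (patterns rs) (λ q → w * someOccurs rs q) p
            ≤⟨ *-monoʳ-≤ 2 (insSum*-mono (patterns rs) (good≤F u v) p) ⟩
          2 * insSum* (patterns rs) (λ q → F (u ∷ v ∷ q)) p
            ≤⟨ *-monoʳ-≤ 2 (insSum*-front (patterns rs) (F ∘ (u ∷_)) v p) ⟩
          2 * insSum* (patterns rs) (F ∘ (u ∷_)) (v ∷ p)
            ≤⟨ *-monoʳ-≤ 2 (insSum*-front (patterns rs) F u (v ∷ p)) ⟩
          2 * insSum* (patterns rs) F (u ∷ v ∷ p) ∎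
          where
          w = k * (a u * b v)
          G = insSum* (patterns rs) (someOccurs rs) p

-- Blocks, hubs and the colours that FirstFit gives them.

module BlocksAndHubs where

  open import Data.Bool using (Bool; true; false; not)
  import Data.Bool.Properties as Bool
  open import Data.Empty using (⊥)
  open import Data.Fin using (Fin; toℕ)
  import Data.Fin.Properties as Fin
  open import Data.List using (List; []; _∷_; map; filter; foldl; length; lookup)
  open import Data.List.Membership.DecPropositional using (_∈?_)
  open import Data.List.Membership.Propositional using (_∈_; _∉_)
  open import Data.List.Membership.Propositional.Properties using (∈-map⁺; ∈-map⁻; ∈-filter⁺; ∈-filter⁻; ∈-deduplicate⁺)
  open import Data.List.Properties using (filter-accept; filter-reject)
  open import Data.List.Relation.Unary.All using (All; []; _∷_)
  import Data.List.Relation.Unary.All as All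
  open import Data.List.Relation.Unary.Any using (here; there; index)
  open import Data.List.Relation.Unary.Any.Properties using (lookup-index)
  open import Data.Nat
  open import Data.Nat.Properties
  open import Data.Product using (_×_; _,_; ∃-syntax; proj₁; proj₂)
  open import Data.Unit using (⊤)
  open import Function using (_∘_; Injective)
  open import Relation.Binary.PropositionalEquality
  open import Relation.Nullary using (¬_; Dec; yes; no; does; contradiction; _×-dec_; ¬?)
  open import Relation.Nullary.Decidable using (dec-true; dec-false)

  pigeonhole-∈ : ∀ {A : Set} {j} {f : Fin j → A} {ys} → Injective _≡_ _≡_ f → (∀ i → f i ∈ ys) → j ≤ length ys
  pigeonhole-∈ {f = f} {ys} f-inj f∈ys = Fin.injective⇒≤ {f = index ∘ f∈ys} λ {i} {i′} eq → f-inj (begin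
    f i                          ≡⟨ lookup-index (f∈ys i) ⟩
    lookup ys (index (f∈ys i))   ≡⟨ cong (lookup ys) eq ⟩
    lookup ys (index (f∈ys i′))  ≡⟨ lookup-index (f∈ys i′) ⟨
    f i′                         ∎)
    where open ≡-Reasoning

  search-correct : ∀ {cs j} → (∀ {i} → i < j → suc i ∈ cs) → suc j ∉ cs →
    ∀ fuel {i} → i ≤ j → j ≤ i + fuel → search cs fuel (suc i) ≡ suc j
  search-correct below j∉cs zero       i≤j j≤i = cong suc (≤-antisym i≤j (subst (_ ≤_) (+-identityʳ _) j≤i))
  search-correct {cs} {j} below j∉cs (suc fuel) {i} i≤j j≤ with i ≟ j
  ... | yes refl rewrite dec-false (_∈?_ _≟_ (suc i) cs) j∉cs = refl
  ... | no  i≢j rewrite dec-true (_∈?_ _≟_ (suc i) cs) (below (≤∧≢⇒< i≤j i≢j)) =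
    search-correct below j∉cs fuel (≤∧≢⇒< i≤j i≢j) (subst (j ≤_) (+-suc i fuel) j≤)

  -- The colours 1, ..., j are j distinct members of `cs`, so `length cs` is enough fuel to reach j
  -- + 1.
  leastMissing-correct : ∀ {cs j} → (∀ {i} → i < j → suc i ∈ cs) → suc j ∉ cs → leastMissing cs ≡ suc j
  leastMissing-correct {cs} below j∉cs =
    search-correct below j∉cs (length cs) z≤n
      (pigeonhole-∈ (Fin.toℕ-injective ∘ suc-injective) (λ i → below (Fin.toℕ<n i)))

  search≥ : ∀ cs fuel c → c ≤ search cs fuel c
  search≥ cs zero       c = ≤-refl
  search≥ cs (suc fuel) c with does (_∈?_ _≟_ c cs)
  ... | true  = ≤-trans (n≤1+n c) (search≥ cs fuel (suc c))
  ... | false = ≤-refl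

  leastMissing≢1 : ∀ {cs} → 1 ∈ cs → leastMissing cs ≢ 1
  leastMissing≢1 {cs@(_ ∷ cs′)} 1∈cs eq
    rewrite dec-true (_∈?_ _≟_ 1 cs) 1∈cs = <⇒≢ (search≥ cs (length cs′) 2) (sym eq)

  odd : ℕ → Bool
  odd zero    = false
  odd (suc n) = not (odd n)

  ⌊2*_+b/2⌋ : ∀ b c → b ≤ 1 → ⌊ b + 2 * c /2⌋ ≡ c
  ⌊2*_+b/2⌋ zero       zero    _ = refl
  ⌊2*_+b/2⌋ zero       (suc c) _ = trans (cong ⌊_/2⌋ (+-suc (suc c) (c + 0))) (cong suc (⌊2*_+b/2⌋ 0 c z≤n))
  ⌊2*_+b/2⌋ (suc zero) zero    _ = refl
  ⌊2*_+b/2⌋ (suc zero) (suc c) _ = trans (cong (⌊_/2⌋ ∘ suc) (+-suc (suc c) (c + 0))) (cong suc (⌊2*_+b/2⌋ 1 c ≤-refl))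
  ⌊2*_+b/2⌋ (suc (suc _)) _ (s≤s ())

  odd-2* : ∀ b c → odd (b + 2 * c) ≡ odd b
  odd-2* zero    zero    = refl
  odd-2* zero    (suc c) = trans (cong odd (cong suc (+-suc c (c + 0)))) (trans (Bool.not-involutive _) (odd-2* 0 c))
  odd-2* (suc b) c       = cong not (odd-2* b c)

  bit : Bool → ℕ
  bit false = 0
  bit true  = 1

  bit≤1 : ∀ b → bit b ≤ 1
  bit≤1 false = z≤n
  bit≤1 true  = ≤-refl

  odd-bit : ∀ b → odd (bit b) ≡ b
  odd-bit false = refl
  odd-bit true  = refl

  ⌊/2⌋<⇒< : ∀ {i j} → ⌊ i /2⌋ < ⌊ j /2⌋ → i < j
  ⌊/2⌋<⇒< lt = ≰⇒> λ j≤i → <⇒≱ lt (⌊n/2⌋-mono j≤i)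

  -- A block is a copy of K_{k,k} minus a perfect matching: its vertices are
  -- 0, …, 2k − 1, the matched pairs are {2c, 2c + 1}, and the side is the parity.
  data Kind : Set where
    block : (r j : ℕ) → Kind
    hub   : Bool → Kind

  side : Kind → Bool
  side (block _ j) = odd j
  side (hub c)     = c

  Linked : Kind → Kind → Set
  Linked (block r i) (block r′ j) = r ≡ r′ × ⌊ i /2⌋ ≢ ⌊ j /2⌋
  Linked (hub _)     (hub _)      = ⊥
  Linked _           _            = ⊤

  Adj : Kind → Kind → Set
  Adj κ κ′ = side κ ≢ side κ′ × Linked κ κ′

  linked? : ∀ κ κ′ → Dec (Linked κ κ′)
  linked? (block r i) (block r′ j) = (r ≟ r′) ×-dec ¬? (⌊ i /2⌋ ≟ ⌊ j /2⌋)
  linked? (block _ _) (hub _)      = yes _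
  linked? (hub _)     (block _ _)  = yes _
  linked? (hub _)     (hub _)      = no λ ()

  linked-sym : ∀ κ κ′ → Linked κ κ′ → Linked κ′ κ
  linked-sym (block _ _) (block _ _) (eq , ne) = sym eq , ne ∘ sym
  linked-sym (block _ _) (hub _)     _         = _
  linked-sym (hub _)     (block _ _) _         = _

  InBlock : ℕ → Kind → Set
  InBlock r (block r′ _) = r′ ≡ r
  InBlock r (hub _)      = ⊥

  inBlock? : ∀ r κ → Dec (InBlock r κ)
  inBlock? r (block r′ _) = r′ ≟ r
  inBlock? r (hub _)      = no λ ()

  -- The invariant of FirstFit along an ordering.

  module Colouring {n : ℕ} (kind : Fin n → Kind) where

    graph : SimpleGraph n
    graph = record
      { _~_      = λ u v → Adj (kind u) (kind v)
      ; _~?_     = λ u v → ¬? (side (kind u) Bool.≟ side (kind v)) ×-dec linked? (kind u) (kind v)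
      ; ~-sym    = λ {u} {v} (ne , lk) → ne ∘ sym , linked-sym (kind u) (kind v) lk
      ; ~-irrefl = λ { refl (ne , _) → ne refl }
      }

    open SimpleGraph graph

    bipartite : Bipartite graph
    bipartite = side ∘ kind , λ _ _ → proj₁

    earlierColours : PartialColouring n → Fin n → List ℕ
    earlierColours done v = map proj₂ (filter (λ uc → v ~? proj₁ uc) done)

    ∈-earlier⁺ : ∀ {done v u c} → (u , c) ∈ done → v ~ u → c ∈ earlierColours done v
    ∈-earlier⁺ {v = v} uc∈ v~u = ∈-map⁺ proj₂ (∈-filter⁺ (λ uc → v ~? proj₁ uc) uc∈ v~u)

    ∈-earlier⁻ : ∀ {done v c} → c ∈ earlierColours done v → ∃[ u ] (u , c) ∈ done × v ~ u
    ∈-earlier⁻ {done} {v} c∈ with ∈-map⁻ proj₂ c∈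
    ... | (u , _) , uc∈ , refl = u , ∈-filter⁻ (λ uc → v ~? proj₁ uc) {xs = done} uc∈

    -- Outside block `r` it is enough to know which vertices have colour 1: other blocks are not
    -- adjacent to block `r`, and a hub only needs its neighbours to avoid colour 1.
    Entry : ℕ → ℕ → Kind → ℕ → Set
    Entry r j (hub _)      c = c ≡ 1
    Entry r j (block r′ i) c = c ≢ 1 × (r′ ≡ r → i < j × c ≡ 2 + ⌊ i /2⌋)

    Entries : ℕ → ℕ → PartialColouring n → Set
    Entries r j = All λ (u , c) → Entry r j (kind u) c

    -- The state after exactly the positions below j of block r were processed,
    -- in increasing order.
    record Progress (r j : ℕ) (done : PartialColouring n) : Set where
      constructor progress
      field
        entries   : Entries r j done
        hubs      : ∀ b → ∃[ u ] (u , 1) ∈ done × kind u ≡ hub b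
        processed : ∀ {i} → i < j → ∃[ u ] (u , 2 + ⌊ i /2⌋) ∈ done × kind u ≡ block r i

    entry-suc : ∀ {r j} κ {c} → Entry r j κ c → Entry r (suc j) κ c
    entry-suc (hub _)     e         = e
    entry-suc (block _ _) (ne , eq) = ne , λ r≡ → let i<j , c≡ = eq r≡ in m<n⇒m<1+n i<j , c≡

    progress-∷ : ∀ {r j done v c} → Entry r j (kind v) c → Progress r j done → Progress r j ((v , c) ∷ done)
    progress-∷ e (progress es hs ps) =
      progress (e ∷ es) (λ b → let u , u∈ , eq = hs b in u , there u∈ , eq)
                        (λ i<j → let u , u∈ , eq = ps i<j in u , there u∈ , eq)

    -- All neighbours of a hub are block vertices, and by the invariant none of these has colour 1.
    hub-colour : ∀ {r j done v b} → Entries r j done → kind v ≡ hub b → leastMissing (earlierColours done v) ≡ 1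
    hub-colour {done = done} {v} {b} es v≡ = leastMissing-correct (λ ()) 1∉
      where
      not1 : ∀ {r j} κ → Adj (hub b) κ → ¬ Entry r j κ 1
      not1 (block _ _) _ (1≢1 , _) = 1≢1 refl
      not1 (hub _)     (_ , ())
      1∉ : 1 ∉ earlierColours done v
      1∉ 1∈ with ∈-earlier⁻ {done} 1∈
      ... | u , u∈ , v~u = not1 (kind u) (subst (λ κ → Adj κ (kind u)) v≡ v~u) (All.lookup es u∈)

    hub-neighbour : ∀ {r j done v r′ i} → Progress r j done → kind v ≡ block r′ i → 1 ∈ earlierColours done v
    hub-neighbour {v = v} {r′} {i} prog v≡ =
      let u , u∈ , u≡ = Progress.hubs prog (not (odd i)) in
      ∈-earlier⁺ u∈ (subst₂ Adj (sym v≡) (sym u≡) (Bool.not-¬ refl , _))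

    -- Colour 1 is taken by an opposite hub, and colour 2 + c with c < `⌊ j /2⌋` by the vertex of
    -- pair c on the opposite side. Within block `r`, colour `2 + ⌊ j /2⌋` can only sit on the same
    -- matched pair, to which `v` is not adjacent.
    next-colour : ∀ {r j done v} → Progress r j done → kind v ≡ block r j →
      leastMissing (earlierColours done v) ≡ 2 + ⌊ j /2⌋
    next-colour {r} {j} {done} {v} prog v≡ = leastMissing-correct below above
      where
      open Progress prog
      below : ∀ {i} → i < suc ⌊ j /2⌋ → suc i ∈ earlierColours done v
      below {zero}  _          = hub-neighbour prog v≡
      below {suc c} (s≤s c<j/2) =
        let u , u∈ , u≡ = processed (⌊/2⌋<⇒< (subst (_< ⌊ j /2⌋) (sym half) c<j/2)) in
        subst (λ h → 2 + h ∈ earlierColours done v) half (∈-earlier⁺ u∈ (subst₂ Adj (sym v≡) (sym u≡)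
          ((λ eq → Bool.not-¬ refl (trans eq opposite)) , refl , λ eq → <⇒≢ c<j/2 (trans (sym half) (sym eq)))))
        where
        b = not (odd j)
        half : ⌊ bit b + 2 * c /2⌋ ≡ c
        half = ⌊2*_+b/2⌋ (bit b) c (bit≤1 b)
        opposite : odd (bit b + 2 * c) ≡ not (odd j)
        opposite = trans (odd-2* (bit b) c) (odd-bit b)
      not-next : ∀ κ → Adj (block r j) κ → ¬ Entry r j κ (2 + ⌊ j /2⌋)
      not-next (hub _)     _ ()
      not-next (block _ i) (_ , r≡ , j≢i) (_ , e) = j≢i (suc-injective (suc-injective (proj₂ (e (sym r≡)))))
      above : 2 + ⌊ j /2⌋ ∉ earlierColours done v
      above c∈ with ∈-earlier⁻ {done} c∈
      ... | u , u∈ , v~u = not-next (kind u) (subst (λ κ → Adj κ (kind u)) v≡ v~u) (All.lookup entries u∈)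

    Ascending : ℕ → ℕ → ℕ → List (Fin n) → Set
    Ascending r j m []      = j ≡ m
    Ascending r j m (v ∷ Q) = kind v ≡ block r j × Ascending r (suc j) m Q

    restrict : ℕ → List (Fin n) → List (Fin n)
    restrict r = filter (inBlock? r ∘ kind)

    process : ∀ {r j m} z {done} → Progress r j done → Ascending r j m (restrict r z) →
      Progress r m (foldl (colourNext graph) done z)
    process         []      prog refl = prog
    process {r} {j} {m} (v ∷ z) {done} prog asc = go (kind v) refl
      where
      c = leastMissing (earlierColours done v)
      skip : Entry r j (kind v) c → ¬ InBlock r (kind v) → Progress r m (foldl (colourNext graph) ((v , c) ∷ done) z)
      skip e v∉ = process z (progress-∷ e prog)
        (subst (Ascending r j m) (filter-reject (inBlock? r ∘ kind) v∉) asc)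
      go : ∀ κ → kind v ≡ κ → Progress r m (foldl (colourNext graph) ((v , c) ∷ done) z)
      go (hub b) v≡ = skip (subst (λ κ → Entry r j κ c) (sym v≡) (hub-colour (Progress.entries prog) v≡))
                           (subst (¬_ ∘ InBlock r) (sym v≡) λ ())
      go (block r′ i) v≡ with r′ ≟ r
      ... | no r′≢r = skip (subst (λ κ → Entry r j κ c) (sym v≡)
                             (leastMissing≢1 (hub-neighbour prog v≡) , λ r′≡r → contradiction r′≡r r′≢r))
                           (subst (¬_ ∘ InBlock r) (sym v≡) r′≢r)
      ... | yes refl = process z (progress (entry ∷ All.map (λ {uc} → entry-suc (kind (proj₁ uc))) entries) hubs′ processed′) (proj₂ asc′)
        where
        open Progress prog
        asc′ : Ascending r j m (v ∷ restrict r z)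
        asc′ = subst (Ascending r j m) (filter-accept (inBlock? r ∘ kind) (subst (InBlock r) (sym v≡) refl)) asc
        v≡j = proj₁ asc′
        c≡ = next-colour prog v≡j
        entry : Entry r (suc j) (kind v) c
        entry = subst (λ κ → Entry r (suc j) κ c) (sym v≡j)
          ((λ c≡1 → contradiction (trans (sym c≡) c≡1) λ ()) , λ _ → n<1+n j , c≡)
        hubs′ : ∀ b → ∃[ u ] (u , 1) ∈ (v , c) ∷ done × kind u ≡ hub b
        hubs′ b = let u , u∈ , eq = hubs b in u , there u∈ , eq
        processed′ : ∀ {i} → i < suc j → ∃[ u ] (u , 2 + ⌊ i /2⌋) ∈ (v , c) ∷ done × kind u ≡ block r i
        processed′ {i} i<1+j with i ≟ j
        ... | yes refl = v , here (cong (v ,_) (sym c≡)) , v≡j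
        ... | no i≢j   = let u , u∈ , eq = processed (≤∧≢⇒< (s≤s⁻¹ i<1+j) i≢j) in u , there u∈ , eq

    -- The two leading hubs are not adjacent, so both receive colour 1 and the invariant holds from
    -- there on. The k colours counted are 2, ..., k + 1, read off at the even positions of the
    -- block.
    manyColours : ∀ {x y z r} k → kind x ≡ hub true → kind y ≡ hub false →
      Ascending r 0 (2 * k) (restrict r z) → k ≤ coloursUsed graph (x ∷ y ∷ z)
    manyColours {x} {y} {z} {r} k x≡ y≡ asc =
      pigeonhole-∈ (Fin.toℕ-injective ∘ suc-injective ∘ suc-injective) λ c →
        let u , u∈ , _ = Progress.processed final (bound c)
            half = ⌊2*_+b/2⌋ 0 (toℕ c) z≤n in
        ∈-deduplicate⁺ _≟_ (subst (λ h → 2 + h ∈ _) half (∈-map⁺ proj₂ u∈))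
      where
      bound : ∀ (c : Fin k) → 2 * toℕ c < 2 * k
      bound c = *-monoʳ-< 2 (Fin.toℕ<n c)
      done₁ = colourNext graph [] x
      c₂ = leastMissing (earlierColours done₁ y)
      entry₁ : Entry r 0 (kind x) 1
      entry₁ = subst (λ κ → Entry r 0 κ 1) (sym x≡) refl
      c₂≡1 : c₂ ≡ 1
      c₂≡1 = hub-colour {r} {0} (entry₁ ∷ []) y≡
      hubs : ∀ b → ∃[ u ] (u , 1) ∈ (y , c₂) ∷ done₁ × kind u ≡ hub b
      hubs true  = x , there (here refl) , x≡
      hubs false = y , here (cong (y ,_) (sym c₂≡1)) , y≡
      start : Progress r 0 ((y , c₂) ∷ done₁)
      start = progress (subst (λ κ → Entry r 0 κ c₂) (sym y≡) c₂≡1 ∷ entry₁ ∷ []) hubs (λ ())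
      final = process z start asc

-- The dense graph: vertex numbering, expectation and minimum degree.

module DenseGraph where

  open Counting
  open BlocksAndHubs
  open import Data.Bool using (Bool; true; false; not)
  import Data.Bool.Properties as Bool
  open import Data.Fin using (Fin; zero; suc; toℕ; fromℕ<; combine; remQuot; splitAt; _↑ˡ_; _↑ʳ_)
  import Data.Fin.Properties as Fin
  open import Data.List using (List; _∷_; _++_; map; concatMap; length; tabulate; allFin)
  open import Data.List.Membership.Propositional.Properties using (∈-filter⁺; ∈-allFin)
  open import Data.List.Properties using (map-tabulate; concatMap-map; map-++; length-tabulate)
  open import Data.List.Relation.Unary.All using (All)
  import Data.List.Relation.Unary.All.Properties as All
  open import Data.List.Relation.Unary.Unique.Propositional.Properties using (allFin⁺)
  open import Data.Nat
  open import Data.Nat.ListAction using (sum)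
  open import Data.Nat.ListAction.Properties using (sum-++)
  open import Data.Nat.Properties
  open import Data.Nat.Tactic.RingSolver using (solve-∀)
  open import Data.Product using (_×_; _,_)
  open import Data.Sum using (_⊎_; inj₁; inj₂; [_,_]′)
  open import Function using (_∘_; const; Injective)
  open import Relation.Binary.PropositionalEquality
  open import Relation.Nullary using (¬_)

  private variable A : Set

  tabulate-+ : ∀ m {n} (f : Fin (m + n) → A) →
    tabulate f ≡ tabulate (λ i → f (i ↑ˡ n)) ++ tabulate (λ j → f (m ↑ʳ j))
  tabulate-+ zero    f = refl
  tabulate-+ (suc m) f = cong (f zero ∷_) (tabulate-+ m (f ∘ suc))

  tabulate-* : ∀ m {n} (f : Fin (m * n) → A) →
    tabulate f ≡ concatMap (λ i → tabulate (λ j → f (combine i j))) (allFin m)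
  tabulate-* zero        f = refl
  tabulate-* (suc m) {n} f = begin
    tabulate f
      ≡⟨ tabulate-+ n f ⟩
    row zero ++ tabulate (λ u → f (n ↑ʳ u))
      ≡⟨ cong (row zero ++_) (tabulate-* m (λ u → f (n ↑ʳ u))) ⟩
    row zero ++ concatMap (row ∘ suc) (allFin m)
      ≡⟨ cong (row zero ++_) (concatMap-map row suc (allFin m)) ⟨
    row zero ++ concatMap row (map suc (allFin m))
      ≡⟨ cong (λ us → row zero ++ concatMap row us) (map-tabulate (λ i → i) suc) ⟩
    concatMap row (allFin (suc m)) ∎
    where
    open ≡-Reasoning
    row : Fin (suc m) → List _
    row i = tabulate (λ j → f (combine i j))

  sum-tabulate : ∀ {n} (w : A → ℕ) (f : Fin n → A) {c} → (∀ i → w (f i) ≡ c) → sum (map w (tabulate f)) ≡ n * c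
  sum-tabulate {n = zero}  w f eq = refl
  sum-tabulate {n = suc n} w f eq = cong₂ _+_ (eq zero) (sum-tabulate w (f ∘ suc) (eq ∘ suc))

  isHub : Bool → Kind → ℕ
  isHub true  (hub true)  = 1
  isHub false (hub false) = 1
  isHub _     _           = 0

  isHub-disjoint : ∀ κ → isHub true κ * isHub false κ ≡ 0
  isHub-disjoint (block _ _) = refl
  isHub-disjoint (hub true)  = refl
  isHub-disjoint (hub false) = refl

  isHub-elim : ∀ b κ → isHub b κ ≡ 0 ⊎ (isHub b κ ≡ 1 × κ ≡ hub b)
  isHub-elim true  (block _ _) = inj₁ refl
  isHub-elim false (block _ _) = inj₁ refl
  isHub-elim true  (hub true)  = inj₂ (refl , refl)
  isHub-elim true  (hub false) = inj₁ refl
  isHub-elim false (hub true)  = inj₁ refl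
  isHub-elim false (hub false) = inj₂ (refl , refl)

  module Construction (k : ℕ) .{{_ : NonZero k}} where

    -- Each side of the blocks has `s` vertices in total and each hub set has `s` as well. Hence `n`
    -- is 4 s, the source of both the degree bound n/4 and the probability 1/16.
    m M s n : ℕ
    m = 2 * k
    M = m !
    s = M * k
    n = M * m + (s + s)

    blockKind : Fin M × Fin m → Kind
    blockKind (r , w) = block (toℕ r) (toℕ w)

    hubKind : Fin s ⊎ Fin s → Kind
    hubKind = [ const (hub true) , const (hub false) ]′

    kind : Fin n → Kind
    kind v = [ blockKind ∘ remQuot {M} m , hubKind ∘ splitAt s ]′ (splitAt (M * m) v)

    blockVertex : Fin M → Fin m → Fin n
    blockVertex r w = combine r w ↑ˡ (s + s)

    hubVertex : Bool → Fin s → Fin n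
    hubVertex true  i = M * m ↑ʳ (i ↑ˡ s)
    hubVertex false i = M * m ↑ʳ (s ↑ʳ i)

    kind-blockVertex : ∀ r w → kind (blockVertex r w) ≡ block (toℕ r) (toℕ w)
    kind-blockVertex r w = trans
      (cong [ blockKind ∘ remQuot {M} m , hubKind ∘ splitAt s ]′ (Fin.splitAt-↑ˡ (M * m) (combine r w) (s + s)))
      (cong blockKind (Fin.remQuot-combine r w))

    kind-hubVertex : ∀ b i → kind (hubVertex b i) ≡ hub b
    kind-hubVertex true  i rewrite Fin.splitAt-↑ʳ (M * m) (s + s) (i ↑ˡ s) | Fin.splitAt-↑ˡ s i s = refl
    kind-hubVertex false i rewrite Fin.splitAt-↑ʳ (M * m) (s + s) (s ↑ʳ i) | Fin.splitAt-↑ʳ s s i = refl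

    open Colouring kind public
    open SimpleGraph graph

    blockList : Fin M → List (Fin n)
    blockList r = tabulate (blockVertex r)

    hubList : List (Fin n)
    hubList = tabulate (hubVertex true) ++ tabulate (hubVertex false)

    -- With the hubs at the end of the list, `permutations` orders the hubs first and then inserts
    -- the blocks.
    allFin-split : allFin n ≡ concatMap blockList (allFin M) ++ hubList
    allFin-split = trans (tabulate-+ (M * m) (λ v → v))
      (cong₂ _++_ (tabulate-* M (_↑ˡ (s + s))) (tabulate-+ s (M * m ↑ʳ_)))

    ascending-tabulate : ∀ {r l} j (f : Fin l → Fin n) → (∀ i → kind (f i) ≡ block r (j + toℕ i)) →
      Ascending r j (j + l) (tabulate f)
    ascending-tabulate {l = zero}      j f eq = sym (+-identityʳ j)
    ascending-tabulate {r} {l = suc l} j f eq =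
      trans (eq zero) (cong (block r) (+-identityʳ j)) ,
      subst (λ e → Ascending r (suc j) e (tabulate (f ∘ suc))) (sym (+-suc j l))
        (ascending-tabulate (suc j) (f ∘ suc) (λ i → trans (eq (suc i)) (cong (block r) (+-suc j (toℕ i)))))

    block-ascending : ∀ r → Ascending (toℕ r) 0 m (blockList r)
    block-ascending r = ascending-tabulate 0 (blockVertex r) (kind-blockVertex r)

    In : Fin M → Fin n → Set
    In r v = InBlock (toℕ r) (kind v)

    in-block : ∀ r → All (In r) (blockList r)
    in-block r = All.tabulate⁺ λ w → subst (InBlock (toℕ r)) (sym (kind-blockVertex r w)) refl

    InBlock-unique : ∀ {r r′} κ → InBlock r κ → InBlock r′ κ → r ≡ r′
    InBlock-unique (block _ _) eq eq′ = trans (sym eq) eq′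

    open Patterns Fin._≟_ In (λ r v → inBlock? (toℕ r) (kind v)) blockList m (λ r → length-tabulate (blockVertex r))
      in-block (λ r≢r′ {v} p p′ → r≢r′ (Fin.toℕ-injective (InBlock-unique (kind v) p p′)))

    weight : Bool → Fin n → ℕ
    weight b v = isHub b (kind v)

    hubs-outside : All (λ v → ∀ r → ¬ In r v) hubList
    hubs-outside = All.++⁺ (All.tabulate⁺ (outside true)) (All.tabulate⁺ (outside false))
      where
      outside : ∀ b i r → ¬ In r (hubVertex b i)
      outside b i r p with () ← subst (InBlock (toℕ r)) (kind-hubVertex b i) p

    total-hubs : ∀ b → sum (map (weight b) hubList) ≡ s
    total-hubs b = begin
      sum (map (weight b) hubList)
        ≡⟨ trans (cong sum (map-++ (weight b) (tabulate (hubVertex true)) _)) (sum-++ (map (weight b) (tabulate (hubVertex true))) _) ⟩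
      sum (map (weight b) (tabulate (hubVertex true))) + sum (map (weight b) (tabulate (hubVertex false)))
        ≡⟨ cong₂ _+_ (part true) (part false) ⟩
      s * isHub b (hub true) + s * isHub b (hub false)
        ≡⟨ one b ⟩
      s ∎
      where
      open ≡-Reasoning
      part : ∀ c → sum (map (weight b) (tabulate (hubVertex c))) ≡ s * isHub b (hub c)
      part c = sum-tabulate (weight b) (hubVertex c) (λ i → cong (isHub b) (kind-hubVertex c i))
      one : ∀ b → s * isHub b (hub true) + s * isHub b (hub false) ≡ s
      one true  = trans (cong₂ _+_ (*-identityʳ s) (*-zeroʳ s)) (+-identityʳ s)
      one false = cong₂ _+_ (*-zeroʳ s) (*-identityʳ s)

    goodOrder : ∀ x y q → k * (weight true x * weight false y) * someOccurs (allFin M) q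
                          ≤ coloursUsed graph (x ∷ y ∷ q)
    goodOrder x y q with isHub-elim true (kind x) | isHub-elim false (kind y)
    ... | inj₁ eq | _       = ≤-trans (≤-reflexive (cong (λ w → w * someOccurs (allFin M) q)
                                (trans (cong (λ w → k * (w * weight false y)) eq) (*-zeroʳ k)))) z≤n
    ... | inj₂ _  | inj₁ eq = ≤-trans (≤-reflexive (cong (λ w → w * someOccurs (allFin M) q)
                                (trans (cong (λ w → k * (weight true x * w)) eq)
                                  (trans (cong (k *_) (*-zeroʳ (weight true x))) (*-zeroʳ k))))) z≤n
    ... | inj₂ (x₁ , x≡) | inj₂ (y₁ , y≡) = begin
      k * (weight true x * weight false y) * someOccurs (allFin M) q
        ≡⟨ cong (_* someOccurs (allFin M) q) (trans (cong₂ (λ u v → k * (u * v)) x₁ y₁) (*-identityʳ k)) ⟩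
      k * someOccurs (allFin M) q
        ≤⟨ someOccurs-bound (allFin M) (λ r eq →
             manyColours {z = q} k x≡ y≡ (subst (Ascending (toℕ r) 0 m) (sym eq) (block-ascending r))) ⟩
      coloursUsed graph (x ∷ y ∷ q) ∎
      where open ≤-Reasoning

    instance
      s≢0 : NonZero s
      s≢0 = m*n≢0 M k {{m !≢0}}

    n≡4s : n ≡ 4 * s
    n≡4s = lemma M k
      where
      lemma : ∀ M k → M * (2 * k) + (M * k + M * k) ≡ 4 * (M * k)
      lemma = solve-∀

    length-hubs : length hubList ≡ s + s
    length-hubs = trans (cong length (sym (tabulate-+ s (M * m ↑ʳ_)))) (length-tabulate {n = s + s} (M * m ↑ʳ_))

    totalColours : ℕ
    totalColours = sum (map (coloursUsed graph) (permutations (allFin n)))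

    -- Orders that begin with a `hub true` followed by a `hub false` have the share s² / (n (n -
    -- 1)), at least s² / n² = 1/16. Some block being ascending costs another factor 2, which gives
    -- 32.
    k*n!≤32*total : k * n ! ≤ 32 * totalColours
    k*n!≤32*total = begin
      k * n !                                            ≡⟨ cong (k *_) n! ⟩
      k * (n * (n ∸ 1) * X)                              ≤⟨ *-monoʳ-≤ k (*-monoˡ-≤ X (*-monoʳ-≤ n (m∸n≤m n 1))) ⟩
      k * (n * n * X)                                    ≡⟨ cong (λ n → k * (n * n * X)) n≡4s ⟩
      k * (4 * s * (4 * s) * X)                          ≡⟨ cong (λ x → k * (4 * s * (4 * s) * x)) (rising-! (M * m) l) ⟨
      k * (4 * s * (4 * s) * (rising (M * m) l * l !))   ≡⟨ regroup k s (rising (M * m) l) (l !) ⟩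
      16 * (rising (M * m) l * (k * (s * s * l !)))      ≡⟨ cong₂ (λ a b → 16 * (rising (M * m) l * (k * (a * b * l !))))
                                                             (total-hubs true) (total-hubs false) ⟨
      16 * (rising (M * m) l * (k * (sum (map (weight true) hubList) * sum (map (weight false) hubList) * l !)))
        ≤⟨ *-monoʳ-≤ 16 (manyGoodOrders (weight true) (weight false) (isHub-disjoint ∘ kind) (allFin⁺ M)
             (length-tabulate {n = M} (λ i → i)) (trans length-hubs s+s) hubs-outside {k = k} goodOrder) ⟩
      16 * (2 * sum (map (coloursUsed graph) (permutations (concatMap blockList (allFin M) ++ hubList))))
        ≡⟨ cong (λ vs → 16 * (2 * sum (map (coloursUsed graph) (permutations vs)))) allFin-split ⟨
      16 * (2 * totalColours)                            ≡⟨ *-assoc 16 2 totalColours ⟨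
      32 * totalColours ∎
      where
      open ≤-Reasoning
      l = (s + s) ∸ 2
      X = (M * m + l) !
      s+s : s + s ≡ 2 + l
      s+s = sym (m+[n∸m]≡n (+-mono-≤ (>-nonZero⁻¹ s) (>-nonZero⁻¹ s)))
      n≡ : n ≡ 2 + (M * m + l)
      n≡ = trans (cong (M * m +_) s+s) (trans (+-suc (M * m) (suc l)) (cong suc (+-suc (M * m) l)))
      n! : n ! ≡ n * (n ∸ 1) * X
      n! rewrite n≡ = sym (*-assoc (2 + (M * m + l)) (1 + (M * m + l)) X)
      regroup : ∀ k s r f → k * (4 * s * (4 * s) * (r * f)) ≡ 16 * (r * (k * (s * s * f)))
      regroup = solve-∀

    ↑-injective : ∀ b → Injective _≡_ _≡_ (hubVertex b)
    ↑-injective true  eq = Fin.↑ˡ-injective s _ _ (Fin.↑ʳ-injective (M * m) _ _ eq)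
    ↑-injective false eq = Fin.↑ʳ-injective s _ _ (Fin.↑ʳ-injective (M * m) _ _ eq)

    position : Bool → Fin k → Fin m
    position b c = fromℕ< {bit b + 2 * toℕ c} (begin-strict
      bit b + 2 * toℕ c    <⟨ +-monoˡ-< (2 * toℕ c) (s≤s (bit≤1 b)) ⟩
      2 + 2 * toℕ c        ≡⟨ *-suc 2 (toℕ c) ⟨
      2 * suc (toℕ c)      ≤⟨ *-monoʳ-≤ 2 (Fin.toℕ<n c) ⟩
      2 * k                ∎)
      where open ≤-Reasoning

    toℕ-position : ∀ b c → toℕ (position b c) ≡ bit b + 2 * toℕ c
    toℕ-position b c = Fin.toℕ-fromℕ< _

    sideVertex : Bool → Fin s → Fin n
    sideVertex b j = let r , c = remQuot k j in blockVertex r (position b c)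

    side-sideVertex : ∀ b j → side (kind (sideVertex b j)) ≡ b
    side-sideVertex b j = let r , c = remQuot {M} k j in
      trans (cong side (kind-blockVertex r (position b c)))
      (trans (cong odd (toℕ-position b c)) (trans (odd-2* (bit b) (toℕ c)) (odd-bit b)))

    position-injective : ∀ b → Injective _≡_ _≡_ (position b)
    position-injective b {c} {c′} eq = Fin.toℕ-injective (*-cancelˡ-≡ _ _ 2 (+-cancelˡ-≡ (bit b) _ _
      (trans (sym (toℕ-position b c)) (trans (cong toℕ eq) (toℕ-position b c′)))))

    sideVertex-injective : ∀ b → Injective _≡_ _≡_ (sideVertex b)
    sideVertex-injective b {j} {j′} eq =
      let r , c = remQuot {M} k j ; r′ , c′ = remQuot {M} k j′
          r≡ , w≡ = Fin.combine-injective r (position b c) r′ (position b c′) (Fin.↑ˡ-injective (s + s) _ _ eq)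
      in trans (sym (Fin.combine-remQuot {M} k j))
           (trans (cong₂ combine r≡ (position-injective b w≡)) (Fin.combine-remQuot {M} k j′))

    -- A block vertex sees the whole opposite hub set; a hub sees the opposite vertex of every
    -- matched pair in every block, enumerated by `sideVertex`.
    degree≥s : ∀ v → s ≤ degree graph v
    degree≥s v = go (kind v) refl
      where
      bound : ∀ {f : Fin s → Fin n} → Injective _≡_ _≡_ f → (∀ i → v ~ f i) → s ≤ degree graph v
      bound f-inj v~f = pigeonhole-∈ f-inj (λ i → ∈-filter⁺ (v ~?_) (∈-allFin _) (v~f i))
      link-hub : ∀ b κ → side κ ≡ not b → Linked (hub b) κ → Adj (hub b) κ
      link-hub b κ eq lk = (λ e → Bool.not-¬ refl (trans e eq)) , lk
      go : ∀ κ → kind v ≡ κ → s ≤ degree graph v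
      go (block r j) v≡ = bound (↑-injective (not (odd j))) λ i →
        subst₂ Adj (sym v≡) (sym (kind-hubVertex (not (odd j)) i)) (Bool.not-¬ refl , _)
      go (hub b) v≡ = bound (sideVertex-injective (not b)) λ i →
        subst (λ κ → Adj κ _) (sym v≡)
          (link-hub b (kind (sideVertex (not b) i)) (side-sideVertex (not b) i)
            (let r , c = remQuot {M} k i in subst (Linked (hub b)) (sym (kind-blockVertex r (position (not b) c))) _))

-- Bounds for the logarithms given as cuts.

module Logarithms where

  open import Algebra.Bundles using (CommutativeRing)
  import Algebra.Properties.Semiring.Exp
  open import Data.Integer as ℤ using (+_; -[1+_])
  import Data.Integer.Properties as ℤ
  open import Data.Nat as ℕ using (ℕ; zero; suc; NonZero)
  import Data.Nat.Properties as ℕ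
  open import Data.Product using (_,_)
  open import Data.Rational hiding (NonZero; _÷_)
  open import Data.Rational.Properties
  import Data.Rational.Unnormalised as ℚᵘ
  import Data.Rational.Unnormalised.Properties as ℚᵘ
  open import Relation.Binary.PropositionalEquality

  open Algebra.Properties.Semiring.Exp (CommutativeRing.semiring +-*-commutativeRing) using (_^_; ^-assocʳ)
  open Cut

  toℚᵘ-/ : ∀ a b .{{_ : NonZero b}} → toℚᵘ (+ a / b) ℚᵘ.≃ (+ a ℚᵘ./ b)
  toℚᵘ-/ a (suc b) = toℚᵘ-fromℚᵘ (ℚᵘ.mkℚᵘ (+ a) b)

  /-mono-≤ : ∀ a b c d .{{_ : NonZero b}} .{{_ : NonZero d}} → a ℕ.* d ℕ.≤ c ℕ.* b → + a / b ≤ + c / d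
  /-mono-≤ a b@(suc _) c d@(suc _) ad≤cb = toℚᵘ-cancel-≤
    (ℚᵘ.≤-respˡ-≃ (ℚᵘ.≃-sym (toℚᵘ-/ a b)) (ℚᵘ.≤-respʳ-≃ (ℚᵘ.≃-sym (toℚᵘ-/ c d))
      (ℚᵘ.*≤* (subst₂ ℤ._≤_ (ℤ.pos-* a d) (ℤ.pos-* c b) (ℤ.+≤+ ad≤cb)))))

  /-*-integer : ∀ a b c .{{_ : NonZero b}} → (+ a / b) * (+ c / 1) ≡ + (a ℕ.* c) / b
  /-*-integer a b@(suc _) c = toℚᵘ-injective (begin
    toℚᵘ ((+ a / b) * (+ c / 1))            ≈⟨ toℚᵘ-homo-* (+ a / b) (+ c / 1) ⟩
    toℚᵘ (+ a / b) ℚᵘ.* toℚᵘ (+ c / 1)      ≈⟨ ℚᵘ.*-cong (toℚᵘ-/ a b) (toℚᵘ-/ c 1) ⟩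
    (+ a ℚᵘ./ b) ℚᵘ.* (+ c ℚᵘ./ 1)          ≈⟨ ℚᵘ.*≡* (cong₂ ℤ._*_ (sym (ℤ.pos-* a c)) (cong +_ (sym (ℕ.*-identityʳ b)))) ⟩
    (+ (a ℕ.* c) ℚᵘ./ b)                    ≈⟨ toℚᵘ-/ (a ℕ.* c) b ⟨
    toℚᵘ (+ (a ℕ.* c) / b)                  ∎)
    where open ℚᵘ.≃-Reasoning

  1/-*-≤ : ∀ d c a b .{{_ : NonZero d}} .{{_ : NonZero b}} → c ℕ.* b ℕ.≤ a ℕ.* d → (+ 1 / d) * (+ c / 1) ≤ + a / b
  1/-*-≤ d c a b cb≤ad = ≤-trans (≤-reflexive (/-*-integer 1 d c))
    (/-mono-≤ (1 ℕ.* c) d a b (ℕ.≤-trans (ℕ.≤-reflexive (cong (ℕ._* b) (ℕ.*-identityˡ c))) cb≤ad))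

  ι : ℕ → ℚ
  ι a = + a / 1

  ι-mono-≤ : ∀ a b → a ℕ.≤ b → ι a ≤ ι b
  ι-mono-≤ a b a≤b = /-mono-≤ a 1 b 1 (ℕ.*-monoˡ-≤ 1 a≤b)

  ι-* : ∀ a b → ι a * ι b ≡ ι (a ℕ.* b)
  ι-* a b = /-*-integer a 1 b

  0≤ι : ∀ a → 0ℚ ≤ ι a
  0≤ι a = ι-mono-≤ 0 a ℕ.z≤n

  *-mono-≤ : ∀ {p q r s} → 0ℚ ≤ q → 0ℚ ≤ r → p ≤ q → r ≤ s → p * r ≤ q * s
  *-mono-≤ {q = q} {r} 0≤q 0≤r p≤q r≤s =
    ≤-trans (*-monoʳ-≤-nonNeg r {{nonNegative 0≤r}} p≤q) (*-monoˡ-≤-nonNeg q {{nonNegative 0≤q}} r≤s)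

  0≤^ : ∀ {p} n → 0ℚ ≤ p → 0ℚ ≤ p ^ n
  0≤^ zero    _   = 0≤ι 1
  0≤^ (suc n) 0≤p = ≤-trans (≤-reflexive (sym (*-zeroˡ 0ℚ))) (*-mono-≤ 0≤p ≤-refl 0≤p (0≤^ n 0≤p))

  ^-monoˡ-≤ : ∀ {p q} n → 0ℚ ≤ p → p ≤ q → p ^ n ≤ q ^ n
  ^-monoˡ-≤ zero    _   _   = ≤-refl
  ^-monoˡ-≤ (suc n) 0≤p p≤q = *-mono-≤ (≤-trans 0≤p p≤q) (0≤^ n 0≤p) p≤q (^-monoˡ-≤ n 0≤p p≤q)

  1^n≡1 : ∀ n → 1ℚ ^ n ≡ 1ℚ
  1^n≡1 zero    = refl
  1^n≡1 (suc n) = trans (*-identityˡ (1ℚ ^ n)) (1^n≡1 n)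

  ι2^ : ∀ n → ι 2 ^ n ≡ ι (2 ℕ.^ n)
  ι2^ zero    = refl
  ι2^ (suc n) = trans (cong (ι 2 *_) (ι2^ n)) (ι-* 2 (2 ℕ.^ n))

  ι2^^ : ∀ a b → ι (2 ℕ.^ a) ^ b ≡ ι (2 ℕ.^ (a ℕ.* b))
  ι2^^ a b = trans (cong (_^ b) (sym (ι2^ a))) (trans (^-assocʳ (ι 2) a b) (ι2^ (a ℕ.* b)))

  2^ℤ-mono : ∀ i {n} → i ℤ.≤ + n → 2^ℤ i ≤ ι (2 ℕ.^ n)
  2^ℤ-mono (+ i) {n} (ℤ.+≤+ i≤n) = ≤-trans (≤-reflexive (ι2^ i)) (ι-mono-≤ (2 ℕ.^ i) (2 ℕ.^ n) (ℕ.^-monoʳ-≤ 2 i≤n))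
  2^ℤ-mono -[1+ i ] {n} _ = ≤-trans (^-monoˡ-≤ {½} {1ℚ} (suc i) (/-mono-≤ 0 1 1 2 ℕ.z≤n) (/-mono-≤ 1 2 1 1 (ℕ.s≤s ℕ.z≤n)))
    (≤-trans (≤-reflexive (1^n≡1 (suc i))) (ι-mono-≤ 1 (2 ℕ.^ n) (ℕ.m^n>0 2 n)))

  2^ℤ-mono⁻ : ∀ i {n} → + n ℤ.≤ i → ι (2 ℕ.^ n) ≤ 2^ℤ i
  2^ℤ-mono⁻ (+ i) {n} (ℤ.+≤+ n≤i) = ≤-trans (ι-mono-≤ (2 ℕ.^ n) (2 ℕ.^ i) (ℕ.^-monoʳ-≤ 2 n≤i)) (≤-reflexive (sym (ι2^ i)))

  ≤ι⇒↥≤ : ∀ {q n} → q ≤ ι n → ↥ q ℤ.≤ + (n ℕ.* ↧ₙ q)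
  ≤ι⇒↥≤ {q@record{}} {n} q≤n with ℚᵘ.≤-respʳ-≃ (toℚᵘ-/ n 1) (toℚᵘ-mono-≤ q≤n)
  ... | ℚᵘ.*≤* le = subst₂ ℤ._≤_ (ℤ.*-identityʳ (↥ q)) (sym (ℤ.pos-* n (↧ₙ q))) le

  ι≤⇒≤↥ : ∀ {q n} → ι n ≤ q → + (n ℕ.* ↧ₙ q) ℤ.≤ ↥ q
  ι≤⇒≤↥ {q@record{}} {n} n≤q with ℚᵘ.≤-respˡ-≃ (toℚᵘ-/ n 1) (toℚᵘ-mono-≤ n≤q)
  ... | ℚᵘ.*≤* le = subst₂ ℤ._≤_ (sym (ℤ.pos-* n (↧ₙ q))) (ℤ.*-identityʳ (↥ q)) le

  -- For q = a / b with n ≤ q one has n b ≤ a, so 2^(n b) ≤ 2^a < s^b ≤ 2^(n b), a contradiction.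
  2^<⇒< : ∀ {q s n} → 0ℚ < s → 2^ q < s → s ≤ ι (2 ℕ.^ n) → q < ι n
  2^<⇒< {q} {s} {n} 0<s 2^q<s s≤2^n = ≰⇒> λ n≤q → <-irrefl refl (begin-strict
    ι (2 ℕ.^ (n ℕ.* ↧ₙ q))  ≤⟨ 2^ℤ-mono⁻ (↥ q) (ι≤⇒≤↥ {q} {n} n≤q) ⟩
    2^ℤ (↥ q)               <⟨ 2^q<s ⟩
    s ^ ↧ₙ q                ≤⟨ ^-monoˡ-≤ (↧ₙ q) (<⇒≤ 0<s) s≤2^n ⟩
    ι (2 ℕ.^ n) ^ ↧ₙ q      ≡⟨ ι2^^ n (↧ₙ q) ⟩
    ι (2 ℕ.^ (n ℕ.* ↧ₙ q))  ∎)
    where open ≤-Reasoning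

  <2^⇒< : ∀ {q s n} → s <2^ q → ι (2 ℕ.^ n) ≤ s → ι n < q
  <2^⇒< {q} {s} {n} s<2^q 2^n≤s = ≰⇒> λ q≤n → <-irrefl refl (begin-strict
    ι (2 ℕ.^ (n ℕ.* ↧ₙ q))  ≡⟨ ι2^^ n (↧ₙ q) ⟨
    ι (2 ℕ.^ n) ^ ↧ₙ q      ≤⟨ ^-monoˡ-≤ (↧ₙ q) (0≤ι (2 ℕ.^ n)) 2^n≤s ⟩
    s ^ ↧ₙ q                <⟨ s<2^q ⟩
    2^ℤ (↥ q)               ≤⟨ 2^ℤ-mono (↥ q) (≤ι⇒↥≤ {q} {n} q≤n) ⟩
    ι (2 ℕ.^ (n ℕ.* ↧ₙ q))  ∎)
    where open ≤-Reasoning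

  -- Here κ bounds log log n from below and c κ bounds log n from above, so κ < y and q y < x < c κ.
  -- Arguing from c ≤ q makes q nonnegative, so negative q need no separate treatment.
  logRatio< : ∀ {n κ c q} → 2 ℕ.^ (2 ℕ.^ κ) ℕ.≤ n → n ℕ.≤ 2 ℕ.^ (c ℕ.* κ) →
    lower (log₂ (fromℕ n) ÷ log₂ (log₂ (fromℕ n))) q → q < ι c
  logRatio< {n} {κ} {c} {q} ≤n n≤ (x , y , (s , 0<s , 2^x<s , s<n) , (t , _ , (u , _ , n<u , u<2^t) , t<2^y) , qy<x) =
    ≰⇒> λ c≤q → <-irrefl refl (begin-strict
      ι (c ℕ.* κ)  ≡⟨ ι-* c κ ⟨
      ι c * ι κ    ≤⟨ *-mono-≤ (≤-trans (0≤ι c) c≤q) (0≤ι κ) c≤q (<⇒≤ κ<y) ⟩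
      q * y        <⟨ qy<x ⟩
      x            <⟨ 2^<⇒< {x} {s} {c ℕ.* κ} 0<s 2^x<s (≤-trans (<⇒≤ s<n) (ι-mono-≤ n (2 ℕ.^ (c ℕ.* κ)) n≤)) ⟩
      ι (c ℕ.* κ)  ∎)
    where
    open ≤-Reasoning
    κ<y : ι κ < y
    κ<y = <2^⇒< {y} {t} {κ} t<2^y (<⇒≤ (<2^⇒< {t} {u} {2 ℕ.^ κ} u<2^t (≤-trans (ι-mono-≤ (2 ℕ.^ 2 ℕ.^ κ) n ≤n) (<⇒≤ n<u))))

  ≥logRatio : ∀ {n κ c d e} .{{_ : NonZero d}} → 2 ℕ.^ (2 ℕ.^ κ) ℕ.≤ n → n ℕ.≤ 2 ℕ.^ (c ℕ.* κ) →
    (+ 1 / d) * ι c ≤ e → e ≥ᶜ ((+ 1 / d) · (log₂ (fromℕ n) ÷ log₂ (log₂ (fromℕ n))))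
  ≥logRatio {n} {κ} {c} {d} {e} ≤n n≤ bound (q , q-lower , e<) = <-irrefl refl (begin-strict
    e                ≤⟨ <⇒≤ e< ⟩
    (+ 1 / d) * q    <⟨ *-monoʳ-<-pos (+ 1 / d) {{normalize-pos 1 d}} (logRatio< {n} {κ} {c} {q} ≤n n≤ q-lower) ⟩
    (+ 1 / d) * ι c  ≤⟨ bound ⟩
    e                ∎)
    where open ≤-Reasoning

-- The size of the graph and the choice of constants.

open DenseGraph
open Logarithms
open import Data.Integer using (+_)
open import Data.Nat as ℕ using (ℕ; zero; suc; NonZero; _≤_; _!)
import Data.Nat.Properties as ℕ
open import Data.Nat.Tactic.RingSolver using (solve-∀)
open import Data.Product using (_×_; _,_; Σ-syntax; ∃-syntax)
open import Data.Rational as ℚ using (ℚ; 0ℚ; _<_; _*_; _/_)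
import Data.Rational.Properties as ℚ
open import Relation.Binary.PropositionalEquality

m!≤m^m : ∀ m → m ! ≤ m ℕ.^ m
m!≤m^m zero    = ℕ.≤-refl
m!≤m^m (suc m) = ℕ.*-monoʳ-≤ (suc m) (ℕ.≤-trans (m!≤m^m m) (ℕ.^-monoˡ-≤ m (ℕ.n≤1+n m)))

2^m≤[1+m]! : ∀ m → 2 ℕ.^ m ≤ suc m !
2^m≤[1+m]! zero    = ℕ.≤-refl
2^m≤[1+m]! (suc m) = ℕ.*-mono-≤ {2} {suc (suc m)} (ℕ.s≤s (ℕ.s≤s ℕ.z≤n)) (2^m≤[1+m]! m)

n≤2^n : ∀ n → n ≤ 2 ℕ.^ n
n≤2^n zero    = ℕ.z≤n
n≤2^n (suc n) = ℕ.≤-trans (ℕ.+-mono-≤ (ℕ.m^n>0 2 n) (n≤2^n n))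
  (ℕ.≤-reflexive (cong (2 ℕ.^ n ℕ.+_) (sym (ℕ.+-identityʳ (2 ℕ.^ n)))))

module _ (k : ℕ) .{{_ : NonZero k}} where
  open Construction k

  minDegree : MinDegree≥ graph ((+ 1 / 4) * (+ n / 1))
  minDegree v = 1/-*-≤ 4 n (degree graph v) 1 (begin
    n ℕ.* 1                ≡⟨ trans (ℕ.*-identityʳ n) n≡4s ⟩
    4 ℕ.* s                ≤⟨ ℕ.*-monoʳ-≤ 4 (degree≥s v) ⟩
    4 ℕ.* degree graph v   ≡⟨ ℕ.*-comm 4 (degree graph v) ⟩
    degree graph v ℕ.* 4   ∎)
    where open ℕ.≤-Reasoning

  -- The bound k/32 is written as 8k/256 because `8 ℕ.* k` is the upper bound for log n / log log n
  -- that `n≤2^` yields.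
  expectation : (+ 1 / 256) * (+ (8 ℕ.* k) / 1) ℚ.≤ expectedColours graph
  expectation = 1/-*-≤ 256 (8 ℕ.* k) totalColours (n !) {{_}} {{n ℕ.!≢0}} (rescale (n !) totalColours k*n!≤32*total)
    where
    open ℕ.≤-Reasoning
    rescale : ∀ f t → k ℕ.* f ≤ 32 ℕ.* t → 8 ℕ.* k ℕ.* f ≤ t ℕ.* 256
    rescale f t kf≤32t = begin
      8 ℕ.* k ℕ.* f        ≡⟨ ℕ.*-assoc 8 k f ⟩
      8 ℕ.* (k ℕ.* f)      ≤⟨ ℕ.*-monoʳ-≤ 8 kf≤32t ⟩
      8 ℕ.* (32 ℕ.* t)     ≡⟨ ℕ.*-assoc 8 32 t ⟨
      8 ℕ.* 32 ℕ.* t       ≡⟨ ℕ.*-comm 256 t ⟩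
      t ℕ.* 256            ∎

  2^k≤n : 2 ℕ.^ k ≤ n
  2^k≤n = begin
    2 ℕ.^ k                       ≤⟨ ℕ.^-monoʳ-≤ 2 (ℕ.m≤m+n k (k ℕ.+ 0)) ⟩
    2 ℕ.^ m                       ≤⟨ 2^m≤[1+m]! m ⟩
    -- Since k ≥ 1, 2k + 1 ≤ 3k.
    suc m ℕ.* M                   ≤⟨ ℕ.*-monoˡ-≤ M (ℕ.+-monoˡ-≤ m (ℕ.>-nonZero⁻¹ k)) ⟩
    (k ℕ.+ 2 ℕ.* k) ℕ.* M         ≤⟨ ℕ.m≤m+n _ (k ℕ.* M) ⟩
    (k ℕ.+ 2 ℕ.* k) ℕ.* M ℕ.+ k ℕ.* M ≡⟨ collect k M ⟩
    4 ℕ.* s                       ≡⟨ n≡4s ⟨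
    n                             ∎
    where
    open ℕ.≤-Reasoning
    collect : ∀ k M → (k ℕ.+ 2 ℕ.* k) ℕ.* M ℕ.+ k ℕ.* M ≡ 4 ℕ.* (M ℕ.* k)
    collect = solve-∀

  -- With m = 2^(κ + 1), the bound n ≤ 4 m^m k is a power of two with exponent 2 + 2k (κ + 1) + κ.
  -- As k and κ are at least 1, this is at most 7 k κ, rounded up to 8 k κ.
  n≤2^ : ∀ {κ} → k ≡ 2 ℕ.^ κ → 1 ≤ κ → n ≤ 2 ℕ.^ (8 ℕ.* k ℕ.* κ)
  n≤2^ {κ} k≡ 1≤κ = begin
    n                                               ≡⟨ n≡4s ⟩
    4 ℕ.* (M ℕ.* k)                                 ≤⟨ ℕ.*-monoʳ-≤ 4 (ℕ.*-monoˡ-≤ k (m!≤m^m m)) ⟩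
    4 ℕ.* (m ℕ.^ m ℕ.* k)                           ≡⟨ cong₂ (λ a b → 4 ℕ.* (a ℕ.^ m ℕ.* b)) (cong (2 ℕ.*_) k≡) k≡ ⟩
    2 ℕ.^ 2 ℕ.* ((2 ℕ.^ suc κ) ℕ.^ m ℕ.* 2 ℕ.^ κ)   ≡⟨ cong (λ a → 4 ℕ.* (a ℕ.* 2 ℕ.^ κ)) (ℕ.^-*-assoc 2 (suc κ) m) ⟩
    2 ℕ.^ 2 ℕ.* (2 ℕ.^ (suc κ ℕ.* m) ℕ.* 2 ℕ.^ κ)   ≡⟨ cong (4 ℕ.*_) (ℕ.^-distribˡ-+-* 2 (suc κ ℕ.* m) κ) ⟨
    2 ℕ.^ 2 ℕ.* 2 ℕ.^ (suc κ ℕ.* m ℕ.+ κ)           ≡⟨ ℕ.^-distribˡ-+-* 2 2 (suc κ ℕ.* m ℕ.+ κ) ⟨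
    2 ℕ.^ (2 ℕ.+ (suc κ ℕ.* m ℕ.+ κ))               ≤⟨ ℕ.^-monoʳ-≤ 2 exponent ⟩
    2 ℕ.^ (8 ℕ.* k ℕ.* κ)                           ∎
    where
    open ℕ.≤-Reasoning
    1≤k = ℕ.>-nonZero⁻¹ k
    e₁ : ∀ k κ → 2 ℕ.+ (suc κ ℕ.* (2 ℕ.* k) ℕ.+ κ) ≡ 2 ℕ.* (1 ℕ.* 1) ℕ.+ 2 ℕ.* (κ ℕ.* k) ℕ.+ 2 ℕ.* (1 ℕ.* k) ℕ.+ κ ℕ.* 1
    e₁ = solve-∀
    e₂ : ∀ k κ → 2 ℕ.* (κ ℕ.* k) ℕ.+ 2 ℕ.* (κ ℕ.* k) ℕ.+ 2 ℕ.* (κ ℕ.* k) ℕ.+ κ ℕ.* k ℕ.+ κ ℕ.* k ≡ 8 ℕ.* k ℕ.* κ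
    e₂ = solve-∀
    exponent : 2 ℕ.+ (suc κ ℕ.* m ℕ.+ κ) ≤ 8 ℕ.* k ℕ.* κ
    exponent = begin
      2 ℕ.+ (suc κ ℕ.* (2 ℕ.* k) ℕ.+ κ)
        ≡⟨ e₁ k κ ⟩
      2 ℕ.* (1 ℕ.* 1) ℕ.+ 2 ℕ.* (κ ℕ.* k) ℕ.+ 2 ℕ.* (1 ℕ.* k) ℕ.+ κ ℕ.* 1
        ≤⟨ ℕ.+-mono-≤ (ℕ.+-mono-≤ (ℕ.+-monoˡ-≤ (2 ℕ.* (κ ℕ.* k)) (ℕ.*-monoʳ-≤ 2 (ℕ.*-mono-≤ 1≤κ 1≤k)))
             (ℕ.*-monoʳ-≤ 2 (ℕ.*-monoˡ-≤ k 1≤κ))) (ℕ.*-monoʳ-≤ κ 1≤k) ⟩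
      2 ℕ.* (κ ℕ.* k) ℕ.+ 2 ℕ.* (κ ℕ.* k) ℕ.+ 2 ℕ.* (κ ℕ.* k) ℕ.+ κ ℕ.* k
        ≤⟨ ℕ.m≤m+n _ (κ ℕ.* k) ⟩
      2 ℕ.* (κ ℕ.* k) ℕ.+ 2 ℕ.* (κ ℕ.* k) ℕ.+ 2 ℕ.* (κ ℕ.* k) ℕ.+ κ ℕ.* k ℕ.+ κ ℕ.* k
        ≡⟨ e₂ k κ ⟩
      8 ℕ.* k ℕ.* κ ∎

theorem4 : ∃[ c₁ ] ∃[ c₂ ] 0ℚ < c₁ × 0ℚ < c₂ ×
    (∀ (N : ℕ) → ∃[ n ] N ≤ n × (Σ[ G ∈ SimpleGraph n ]
    Bipartite G ×
    MinDegree≥ G (c₁ * (+ n / 1)) ×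
    expectedColours G ≥ᶜ (c₂ · (log₂ (fromℕ n) ÷ log₂ (log₂ (fromℕ n))))))
theorem4 = + 1 / 4 , + 1 / 256 , ℚ.positive⁻¹ (+ 1 / 4) , ℚ.positive⁻¹ (+ 1 / 256) , λ N →
  -- Taking k a power of two makes log₂ k the natural number κ, so both bounds on n have natural
  -- exponents. The successor ensures κ ≥ 1, and N ≤ κ ≤ k ≤ n makes the graphs arbitrarily large.
  let κ = suc N
      k = 2 ℕ.^ κ
      instance k≢0 = ℕ.m^n≢0 2 κ
      open Construction k
  in n , ℕ.≤-trans (ℕ.≤-trans (ℕ.n≤1+n N) (n≤2^n κ)) (ℕ.≤-trans (n≤2^n k) (2^k≤n k)) ,
     graph , bipartite , minDegree k ,
     ≥logRatio {n} {κ} {8 ℕ.* k} {256} (2^k≤n k) (n≤2^ k {κ} refl (ℕ.s≤s ℕ.z≤n)) (expectation k)
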